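{- $c(C_5,B)=c_1(C_5,B)=1/16$, where $C_5$ is the cycle of length 5 and $B$ is the banner graph.
   Context: The banner graph $B$ is obtained from the 4-cycle $C_4$ by adding a pendant edge (a new vertex joined to one vertex of the cycle). For graphs $H,G$, $t(H,G)=\hom(H,G)/v(G)^{v(H)}$ is the probability that a uniformly random map $V(H)\to V(G)$ is a homomorphism. Let $G_1,G_2,\dots$ be a sequence containing every finite graph exactly once; $\overline{G}$ is the complement of $G$. For $\lambda\in[0,2]$, $c_\lambda(H_1,H_2):=\liminf_{n\to\infty}\left[\lambda\, t(H_1,G_n)+(2-\lambda)\, t(H_2,\overline{G_n})\right]$, and $c(H_1,H_2):=\sup_{\lambda\in[0,2]}c_\lambda(H_1,H_2)$.
   Formalization: The parameter λ in c(C_5,B) = sup over λ in [0,2] of c_λ ranges over the rational numbers in [0,2] instead of all real ones. -}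

module Defs where

open import Data.Bool using (Bool; true; false; _∧_; _∨_; not; if_then_else_; T)
open import Data.Bool.Properties using (∨-comm)
open import Data.Nat as ℕ using (ℕ; zero; suc; NonZero)
open import Data.Fin using (Fin; zero; suc; toℕ; _≟_)
open import Data.List using (List; []; _∷_; map; concatMap; filter; length)
open import Data.Bool.ListAction using (all)
open import Data.List using () renaming (allFin to allFinL)
open import Data.Product using (Σ; _×_; _,_)
open import Data.Rational as ℚ using (ℚ; _/_; _≤_; _<_; _+_; _-_; _*_; 0ℚ; 1ℚ)
open import Data.Integer using (+_)
open import Relation.Binary.PropositionalEquality using (_≡_; refl; sym; trans)
open import Relation.Nullary using (yes; no)
open import Relation.Nullary.Decidable using (⌊_⌋)

record Graph (n : ℕ) : Set where
  field
    adj    : Fin n → Fin n → Bool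
    adj-sym : ∀ i j → adj i j ≡ adj j i
    adj-irr : ∀ i → adj i i ≡ false
open Graph public

complement : ∀ {n} → Graph n → Graph n
complement {n} G = record { adj = a ; adj-sym = s ; adj-irr = r }
  where
  a : Fin n → Fin n → Bool
  a i j with i ≟ j
  ... | yes _ = false
  ... | no  _ = not (adj G i j)
  s : ∀ i j → a i j ≡ a j i
  s i j with i ≟ j | j ≟ i
  ... | yes _ | yes _ = refl
  ... | yes p | no q = Data.Empty.⊥-elim (q (sym p)) where import Data.Empty
  ... | no q | yes p = Data.Empty.⊥-elim (q (sym p)) where import Data.Empty
  ... | no _ | no _ rewrite adj-sym G i j = refl
  r : ∀ i → a i i ≡ false
  r i with i ≟ i
  ... | yes _ = refl
  ... | no q = Data.Empty.⊥-elim (q refl) where import Data.Empty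

allMaps : ∀ k n → List (Fin k → Fin n)
allMaps zero    n = (λ ()) ∷ []
allMaps (suc k) n = concatMap (λ f → map (λ a → cons a f) (allFinL n)) (allMaps k n)
  where
  cons : Fin n → (Fin k → Fin n) → Fin (suc k) → Fin n
  cons a f zero    = a
  cons a f (suc i) = f i

isHom : ∀ {k n} → Graph k → Graph n → (Fin k → Fin n) → Bool
isHom {k} H G f =
  all (λ i → all (λ j → if adj H i j then adj G (f i) (f j) else true) (allFinL k)) (allFinL k)

hom : ∀ {k n} → Graph k → Graph n → ℕ
hom {k} {n} H G = length (filter (λ f → T? (isHom H G f)) (allMaps k n))
  where
  open import Data.Bool.Properties using () renaming (T? to T?)

t : ∀ {k n} .{{_ : NonZero n}} → Graph k → Graph n → ℚ
t {k} {n} H G = (+ hom H G) / (n ℕ.^ k)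
  where instance _ = ℕ.m^n≢0 n k where import Data.Nat.Properties as ℕ

edgeIn : ∀ {n} → List (ℕ × ℕ) → Fin n → Fin n → Bool
edgeIn [] i j = false
edgeIn ((a , b) ∷ es) i j = (⌊ toℕ i ℕ.≟ a ⌋ ∧ ⌊ toℕ j ℕ.≟ b ⌋) ∨ edgeIn es i j

C5edges : List (ℕ × ℕ)
C5edges = (0 , 1) ∷ (1 , 2) ∷ (2 , 3) ∷ (3 , 4) ∷ (4 , 0) ∷ []

C5 : Graph 5
C5 = record
  { adj = λ i j → edgeIn C5edges i j ∨ edgeIn C5edges j i
  ; adj-sym = λ i j → ∨-comm (edgeIn C5edges i j) (edgeIn C5edges j i)
  ; adj-irr = irr }
  where
  irr : ∀ i → (edgeIn C5edges i i ∨ edgeIn C5edges i i) ≡ false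
  irr zero = refl
  irr (suc zero) = refl
  irr (suc (suc zero)) = refl
  irr (suc (suc (suc zero))) = refl
  irr (suc (suc (suc (suc zero)))) = refl

Bedges : List (ℕ × ℕ)
Bedges = (0 , 1) ∷ (1 , 2) ∷ (2 , 3) ∷ (3 , 0) ∷ (0 , 4) ∷ []

Banner : Graph 5
Banner = record
  { adj = λ i j → edgeIn Bedges i j ∨ edgeIn Bedges j i
  ; adj-sym = λ i j → ∨-comm (edgeIn Bedges i j) (edgeIn Bedges j i)
  ; adj-irr = irr }
  where
  irr : ∀ i → (edgeIn Bedges i i ∨ edgeIn Bedges i i) ≡ false
  irr zero = refl
  irr (suc zero) = refl
  irr (suc (suc zero)) = refl
  irr (suc (suc (suc zero))) = refl
  irr (suc (suc (suc (suc zero)))) = refl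

objective : ∀ {k₁ k₂} → Graph k₁ → Graph k₂ → ℚ → ∀ n .{{_ : NonZero n}} → Graph n → ℚ
objective H₁ H₂ lam n G = lam * t H₁ G + ((+ 2 / 1) - lam) * t H₂ (complement G)

GFun : Set
GFun = ∀ n .{{_ : NonZero n}} → Graph n → ℚ

-- liminf over an enumeration of all finite graphs (finitely many per order),
-- unfolded: "liminf ≥ x" and "liminf ≤ x".
LiminfGe : GFun → ℚ → Set
LiminfGe F x = ∀ (ε : ℚ) → 0ℚ < ε →
  Σ ℕ λ M → ∀ n .{{_ : NonZero n}} → M ℕ.≤ n → (G : Graph n) → x - ε ≤ F n G

LiminfLe : GFun → ℚ → Set
LiminfLe F x = ∀ (ε : ℚ) → 0ℚ < ε → ∀ (M : ℕ) →
  Σ ℕ λ n → Σ (NonZero n) λ nz → M ℕ.≤ n × Σ (Graph n) λ G → F n {{nz}} G ≤ x + ε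

IsCλ : ∀ {k₁ k₂} → Graph k₁ → Graph k₂ → ℚ → ℚ → Set
IsCλ H₁ H₂ lam x = LiminfGe (objective H₁ H₂ lam) x × LiminfLe (objective H₁ H₂ lam) x

-- c(H1,H2) = sup_{λ ∈ [0,2]} c_λ(H1,H2) = x  (λ ranging over rationals)
IsC : ∀ {k₁ k₂} → Graph k₁ → Graph k₂ → ℚ → Set
IsC H₁ H₂ x =
  (∀ lam → 0ℚ ≤ lam → lam ≤ (+ 2 / 1) → LiminfLe (objective H₁ H₂ lam) x)
  × (∀ (ε : ℚ) → 0ℚ < ε → Σ ℚ λ lam → 0ℚ ≤ lam × lam ≤ (+ 2 / 1) × LiminfGe (objective H₁ H₂ lam) (x - ε))

{-# OPTIONS --safe #-}
module Submission where

open import Defs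
open import Data.Product using (_×_)
open import Data.Integer using (+_)
open import Data.Rational using (_/_; 1ℚ)
open import Algebra.Bundles using (CommutativeRing)
open import Data.Bool using (Bool; true; false; _∧_; not)
open import Data.Bool.Properties using (T?)
open import Data.Fin as Fin using (Fin; zero; suc; _↑ˡ_; _↑ʳ_; remQuot; quotient; remainder)
open import Data.Fin.Patterns using (0F; 1F; 2F; 3F; 4F)
open import Data.Fin.Properties using (splitAt-↑ˡ; splitAt-↑ʳ)
open import Data.Integer as ℤ using (ℤ; -[1+_]; 0ℤ; 1ℤ; -1ℤ; +≤+; -≤+)
import Data.Integer.Properties as ℤ
open import Data.Integer.Tactic.RingSolver using (solve-∀)
open import Data.List using (List; []; _∷_; _++_; map; concatMap; filter; length; tabulate; allFin)
open import Data.Nat as ℕ using (ℕ; zero; suc; z≤n; s≤s)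
import Data.Nat.Properties as ℕ
import Data.Nat.Tactic.RingSolver as ℕ-Solver
open import Data.Product as Product using (Σ; _,_; proj₁; proj₂)
open import Data.Rational as ℚ using (ℚ; mkℚ; 0ℚ; ↧ₙ_; toℚᵘ; NonNegative; Positive)
import Data.Rational.Properties as ℚ
import Data.Rational.Solver as ℚ-Solver
open import Data.Rational.Unnormalised as ℚᵘ using (mkℚᵘ; *≡*; *≤*)
import Data.Rational.Unnormalised.Properties as ℚᵘ
open import Data.Sum using (_⊎_; inj₁; inj₂)
open import Data.Unit using (⊤; tt)
open import Data.Vec as Vec using (Vec; []; _∷_; lookup)
open import Data.Vec.Properties using (lookup-map)
open import Function using (_∘_; id)
open import Relation.Binary.PropositionalEquality
open import Relation.Nullary using (Dec; yes; no; contradiction; does)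
open import Relation.Nullary.Decidable using (_×-dec_; toWitness)

-- Lower bound.  For a symmetric nonnegative matrix W let P(x , y) = (W²)(x , y).  Summing
-- W(a , e) (P(a , c) − P(e , c))² ≥ 0 over all a, e, c shows that W contains at least as many banners as
-- 5-cycles, so it suffices to bound the number of 5-cycles in G plus that in its complement.  Up to O(n⁴)
-- degenerate maps these are the 5-cycle counts of (1 + U)/2 and (1 − U)/2 for a symmetric matrix U; in their
-- sum the odd terms cancel, and each even term (two edges with a common vertex, two disjoint edges, a path
-- with four edges) is a sum of squares.
--
-- Upper bound.  A quasirandom graph of density 1/2 has both densities tending to 1/32, which gives 1/16 for
-- every λ.  We take the graph of the Sylvester–Hadamard matrix H = K ⊗ ... ⊗ K, where K is 2 × 2.
-- Expanding ∏ (1 ± H(e)) over the edges, the sum belonging to a set of edges is multiplicative in ⊗, so it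
-- suffices to check that for K it is at most half of its trivial bound 2⁵ for each nonempty edge set.

module Counting where

  open import Data.Integer using (_+_; _*_; _-_; ∣_∣; _≤_; _≟_; nonNegative)
  open import Algebra.Properties.CommutativeSemigroup ℤ.*-commutativeSemigroup using (interchange)
  open import Algebra.Properties.Semiring.Sum (CommutativeRing.semiring ℤ.+-*-commutativeRing)

  -- Homomorphism counts as iterated sums

  ∑ᵛ : ∀ {n} k → (Vec (Fin n) k → ℤ) → ℤ
  ∑ᵛ zero    F = F []
  ∑ᵛ (suc k) F = sum λ a → ∑ᵛ k (λ v → F (a ∷ v))

  Pattern : ℕ → Set
  Pattern k = List (Fin k × Fin k)

  weight : ∀ {n k} → (Fin n → Fin n → ℤ) → Pattern k → Vec (Fin n) k → ℤ
  weight W []             v = 1ℤ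
  weight W ((i , j) ∷ es) v = W (lookup v i) (lookup v j) * weight W es v

  homs : ∀ {n k} → (Fin n → Fin n → ℤ) → Pattern k → ℤ
  homs {k = k} W es = ∑ᵛ k (weight W es)

  ι : Bool → ℤ
  ι true  = 1ℤ
  ι false = 0ℤ

  sumList : ∀ {A : Set} → (A → ℤ) → List A → ℤ
  sumList F []       = 0ℤ
  sumList F (x ∷ xs) = F x + sumList F xs

  +length-filter : ∀ {A : Set} (P : A → Bool) xs →
    + length (filter (λ x → T? (P x)) xs) ≡ sumList (ι ∘ P) xs
  +length-filter P []       = refl
  +length-filter P (x ∷ xs) with P x
  ... | true  = cong (λ s → 1ℤ + s) (+length-filter P xs)
  ... | false = trans (+length-filter P xs) (sym (ℤ.+-identityˡ _))

  sumList-++ : ∀ {A : Set} (F : A → ℤ) xs ys → sumList F (xs ++ ys) ≡ sumList F xs + sumList F ys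
  sumList-++ F []       ys = sym (ℤ.+-identityˡ _)
  sumList-++ F (x ∷ xs) ys = trans (cong (λ s → F x + s) (sumList-++ F xs ys)) (sym (ℤ.+-assoc (F x) _ _))

  sumList-map-tabulate : ∀ {A B : Set} {n} (F : B → ℤ) (g : A → B) (h : Fin n → A) →
    sumList F (map g (tabulate h)) ≡ sum (F ∘ g ∘ h)
  sumList-map-tabulate {n = zero}  F g h = refl
  sumList-map-tabulate {n = suc n} F g h = cong (λ s → F (g (h zero)) + s) (sumList-map-tabulate F g (h ∘ suc))

  module _ {A B : Set} {n : ℕ} where

    sumList-concatMap : (F : B → ℤ) (c : Fin n → A → B) (ys : List A) →
      sumList F (concatMap (λ f → map (λ a → c a f) (allFin n)) ys) ≡ sumList (λ f → sum (λ a → F (c a f))) ys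
    sumList-concatMap F c []       = refl
    sumList-concatMap F c (y ∷ ys) = trans (sumList-++ F (map (λ a → c a y) (allFin n)) _)
      (cong₂ _+_ (sumList-map-tabulate F (λ a → c a y) id) (sumList-concatMap F c ys))

  -- The where-bound function with which allMaps extends a map cannot be named here; unification recovers it.
  allMaps-suc : ∀ k n → Σ (Fin n → (Fin k → Fin n) → Fin (suc k) → Fin n) λ c →
    allMaps (suc k) n ≡ concatMap (λ f → map (λ a → c a f) (allFin n)) (allMaps k n)
  allMaps-suc k n = _ , refl

  extend : ∀ {k n} → Fin n → (Fin k → Fin n) → Fin (suc k) → Fin n
  extend {k} {n} = proj₁ (allMaps-suc k n)

  sumList-allMaps-suc : ∀ k n (F : (Fin (suc k) → Fin n) → ℤ) →
    sumList F (allMaps (suc k) n) ≡ sumList (λ f → sum λ a → F (extend a f)) (allMaps k n)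
  sumList-allMaps-suc k n F = sumList-concatMap F extend (allMaps k n)

  -- Built from `extend`, so that peeling off five coordinates of `allMaps` produces exactly this
  -- map by computation.
  vertices : ∀ {n} → Fin n → Fin n → Fin n → Fin n → Fin n → Fin 5 → Fin n
  vertices a b c d e = extend e (extend d (extend c (extend b (extend a λ ()))))

  sumList-allMaps₅ : ∀ {n} (F : (Fin 5 → Fin n) → ℤ) →
    sumList F (allMaps 5 n) ≡ (sum λ a → sum λ b → sum λ c → sum λ d → sum λ e → F (vertices a b c d e))
  sumList-allMaps₅ {n} F =
    trans (sumList-allMaps-suc 4 n _) (trans (sumList-allMaps-suc 3 n _) (trans (sumList-allMaps-suc 2 n _)
      (trans (sumList-allMaps-suc 1 n _) (trans (sumList-allMaps-suc 0 n _) (ℤ.+-identityʳ _)))))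

  -- Position i of a vector is the image of vertex 4 − i: allMaps varies the image of vertex 0 fastest.
  cycle₅ banner : Pattern 5
  cycle₅ = (3F , 4F) ∷ (4F , 0F) ∷ (2F , 3F) ∷ (1F , 2F) ∷ (0F , 1F) ∷ []
  banner = (4F , 3F) ∷ (4F , 1F) ∷ (4F , 0F) ∷ (3F , 2F) ∷ (2F , 1F) ∷ []

  sum-cong₅ : ∀ {n} {F G : Fin n → Fin n → Fin n → Fin n → Fin n → ℤ} → (∀ a b c d e → F a b c d e ≡ G a b c d e) →
    (sum λ a → sum λ b → sum λ c → sum λ d → sum λ e → F a b c d e) ≡
    (sum λ a → sum λ b → sum λ c → sum λ d → sum λ e → G a b c d e)
  sum-cong₅ p = sum-cong-≗ λ a → sum-cong-≗ λ b → sum-cong-≗ λ c → sum-cong-≗ λ d → sum-cong-≗ λ e → p a b c d e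

  adjℤ : ∀ {n} → Graph n → Fin n → Fin n → ℤ
  adjℤ G i j = ι (adj G i j)

  -- `isHom` tests each edge in both directions. Once symmetry identifies the two tests, five
  -- Booleans remain. The pattern lists its edges in the order in which `isHom` meets them, so the
  -- case split can stop at the first `false`.
  +hom-C5 : ∀ {n} (G : Graph n) → + hom C5 G ≡ homs (adjℤ G) cycle₅
  +hom-C5 {n} G = trans (+length-filter (isHom C5 G) (allMaps 5 n))
    (trans (sumList-allMaps₅ {n} (λ f → ι (isHom C5 G f))) (sum-cong₅ go))
    where
    go : ∀ a b c d e → ι (isHom C5 G (vertices a b c d e)) ≡ weight (adjℤ G) cycle₅ (a ∷ b ∷ c ∷ d ∷ e ∷ [])
    go a b c d e
      rewrite adj-sym G e d | adj-sym G a e | adj-sym G d c | adj-sym G c b | adj-sym G b a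
      with adj G d e | adj G e a | adj G c d | adj G b c | adj G a b
    ... | false | _     | _     | _     | _     = refl
    ... | true  | false | _     | _     | _     = refl
    ... | true  | true  | false | _     | _     = refl
    ... | true  | true  | true  | false | _     = refl
    ... | true  | true  | true  | true  | false = refl
    ... | true  | true  | true  | true  | true  = refl

  +hom-Banner : ∀ {n} (G : Graph n) → + hom Banner G ≡ homs (adjℤ G) banner
  +hom-Banner {n} G = trans (+length-filter (isHom Banner G) (allMaps 5 n))
    (trans (sumList-allMaps₅ {n} (λ f → ι (isHom Banner G f))) (sum-cong₅ go))
    where
    go : ∀ a b c d e → ι (isHom Banner G (vertices a b c d e)) ≡ weight (adjℤ G) banner (a ∷ b ∷ c ∷ d ∷ e ∷ [])
    go a b c d e
      rewrite adj-sym G d e | adj-sym G b e | adj-sym G a e | adj-sym G c d | adj-sym G b c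
      with adj G e d | adj G e b | adj G e a | adj G d c | adj G c b
    ... | false | _     | _     | _     | _     = refl
    ... | true  | false | _     | _     | _     = refl
    ... | true  | true  | false | _     | _     = refl
    ... | true  | true  | true  | false | _     = refl
    ... | true  | true  | true  | true  | false = refl
    ... | true  | true  | true  | true  | true  = refl

  -- Counting in Sylvester–Hadamard matrices

  sum-mono-≤ : ∀ {n} {f g : Fin n → ℤ} → (∀ i → f i ≤ g i) → sum f ≤ sum g
  sum-mono-≤ {zero}  p = ℤ.≤-refl
  sum-mono-≤ {suc n} p = ℤ.+-mono-≤ (p zero) (sum-mono-≤ (p ∘ suc))

  sum-const : ∀ n (c : ℤ) → sum {n} (λ _ → c) ≡ + n * c
  sum-const zero    c = refl
  sum-const (suc n) c = trans (cong (_+_ c) (sum-const n c)) (sym (ℤ.suc-* (+ n) c))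

  ∑ᵛ-cong : ∀ {n} k {F G : Vec (Fin n) k → ℤ} → (∀ v → F v ≡ G v) → ∑ᵛ k F ≡ ∑ᵛ k G
  ∑ᵛ-cong zero    p = p []
  ∑ᵛ-cong (suc k) p = sum-cong-≗ λ a → ∑ᵛ-cong k (λ v → p (a ∷ v))

  ∑ᵛ-mono-≤ : ∀ {n} k {F G : Vec (Fin n) k → ℤ} → (∀ v → F v ≤ G v) → ∑ᵛ k F ≤ ∑ᵛ k G
  ∑ᵛ-mono-≤ zero    p = p []
  ∑ᵛ-mono-≤ (suc k) p = sum-mono-≤ λ a → ∑ᵛ-mono-≤ k (λ v → p (a ∷ v))

  ∑ᵛ-distrib-+ : ∀ {n} k (F G : Vec (Fin n) k → ℤ) → ∑ᵛ k (λ v → F v + G v) ≡ ∑ᵛ k F + ∑ᵛ k G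
  ∑ᵛ-distrib-+ zero    F G = refl
  ∑ᵛ-distrib-+ (suc k) F G = trans (sum-cong-≗ λ a → ∑ᵛ-distrib-+ k (F ∘ (a ∷_)) (G ∘ (a ∷_)))
    (∑-distrib-+ (λ a → ∑ᵛ k (F ∘ (a ∷_))) _)

  *-distribˡ-∑ᵛ : ∀ {n} k c (F : Vec (Fin n) k → ℤ) → c * ∑ᵛ k F ≡ ∑ᵛ k (λ v → c * F v)
  *-distribˡ-∑ᵛ zero    c F = refl
  *-distribˡ-∑ᵛ (suc k) c F = trans (*-distribˡ-sum c (λ a → ∑ᵛ k (F ∘ (a ∷_))))
    (sum-cong-≗ λ a → *-distribˡ-∑ᵛ k c (F ∘ (a ∷_)))

  ∑ᵛ-one : ∀ {n} k → ∑ᵛ {n} k (λ _ → 1ℤ) ≡ + (n ℕ.^ k)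
  ∑ᵛ-one     zero    = refl
  ∑ᵛ-one {n} (suc k) = trans (sum-const n _) (trans (cong (+ n *_) (∑ᵛ-one k)) (sym (ℤ.pos-* n (n ℕ.^ k))))

  sum-+ : ∀ m {n} (f : Fin (m ℕ.+ n) → ℤ) → sum f ≡ sum (f ∘ (_↑ˡ n)) + sum (f ∘ (m ↑ʳ_))
  sum-+ zero    f = sym (ℤ.+-identityˡ _)
  sum-+ (suc m) f = trans (cong (_+_ (f zero)) (sum-+ m (f ∘ suc))) (sym (ℤ.+-assoc (f zero) _ _))

  sum-remQuot : ∀ m n (f : Fin m × Fin n → ℤ) → sum (f ∘ remQuot {m} n) ≡ sum λ a → sum λ b → f (a , b)
  sum-remQuot zero    n f = refl
  sum-remQuot (suc m) n f = trans (sum-+ n (f ∘ remQuot {suc m} n)) (cong₂ _+_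
    (sum-cong-≗ λ b → cong f (left b))
    (trans (sum-cong-≗ λ i → cong f (right i)) (sum-remQuot m n (f ∘ Product.map₁ suc))))
    where
    left : ∀ b → remQuot {suc m} n (b ↑ˡ m ℕ.* n) ≡ (zero , b)
    left b rewrite splitAt-↑ˡ n b (m ℕ.* n) = refl
    right : ∀ i → remQuot {suc m} n (n ↑ʳ i) ≡ Product.map₁ suc (remQuot {m} n i)
    right i rewrite splitAt-↑ʳ n (m ℕ.* n) i = refl

  infixr 7 _⊗_
  _⊗_ : ∀ {m n} → (Fin m → Fin m → ℤ) → (Fin n → Fin n → ℤ) → Fin (m ℕ.* n) → Fin (m ℕ.* n) → ℤ
  _⊗_ {m} {n} V W i j = V (quotient n i) (quotient n j) * W (remainder {m} n i) (remainder {m} n j)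

  sum-*-sum : ∀ {m n} (f : Fin m → ℤ) (g : Fin n → ℤ) → (sum λ a → sum λ b → f a * g b) ≡ sum f * sum g
  sum-*-sum f g = trans (sum-cong-≗ λ a → sym (*-distribˡ-sum (f a) g)) (sym (*-distribʳ-sum (sum g) f))

  ∑ᵛ-remQuot : ∀ {m n} k (F : Vec (Fin m) k → ℤ) (G : Vec (Fin n) k → ℤ) →
    ∑ᵛ k (λ v → F (Vec.map (quotient n) v) * G (Vec.map (remainder {m} n) v)) ≡ ∑ᵛ k F * ∑ᵛ k G
  ∑ᵛ-remQuot zero F G = refl
  ∑ᵛ-remQuot {m} {n} (suc k) F G = trans
    (sum-cong-≗ λ i → ∑ᵛ-remQuot k (λ v → F (quotient n i ∷ v)) (λ v → G (remainder {m} n i ∷ v)))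
    (trans (sum-remQuot m n (λ p → ∑ᵛ k (λ v → F (proj₁ p ∷ v)) * ∑ᵛ k (λ v → G (proj₂ p ∷ v))))
      (sum-*-sum (λ a → ∑ᵛ k (λ v → F (a ∷ v))) (λ b → ∑ᵛ k (λ v → G (b ∷ v)))))

  weight-⊗ : ∀ {m n k} (V : Fin m → Fin m → ℤ) (W : Fin n → Fin n → ℤ) (es : Pattern k) v →
    weight (V ⊗ W) es v ≡ weight V es (Vec.map (quotient n) v) * weight W es (Vec.map (remainder {m} n) v)
  weight-⊗ V W [] v = refl
  weight-⊗ {m} {n} V W ((i , j) ∷ es) v
    rewrite lookup-map i (quotient {m} n) v | lookup-map j (quotient {m} n) v
          | lookup-map i (remainder {m} n) v | lookup-map j (remainder {m} n) v
    = trans (cong ((V ⊗ W) (lookup v i) (lookup v j) *_) (weight-⊗ V W es v)) (interchange (V _ _) (W _ _) _ _)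

  -- A map into the index set of a Kronecker product is a pair of maps into the two factors, and its
  -- weight is the product of their weights.
  homs-⊗ : ∀ {m n k} (V : Fin m → Fin m → ℤ) (W : Fin n → Fin n → ℤ) (es : Pattern k) →
    homs (V ⊗ W) es ≡ homs V es * homs W es
  homs-⊗ {k = k} V W es = trans (∑ᵛ-cong k (weight-⊗ V W es)) (∑ᵛ-remQuot k (weight V es) (weight W es))

  hadamard₂ : Fin 2 → Fin 2 → ℤ
  hadamard₂ 1F 1F = -1ℤ
  hadamard₂ _  _  = 1ℤ

  sylvester : ∀ m → Fin (2 ℕ.^ m) → Fin (2 ℕ.^ m) → ℤ
  sylvester zero    = λ _ _ → 1ℤ
  sylvester (suc m) = hadamard₂ ⊗ sylvester m

  weight-one : ∀ {n k} (es : Pattern k) (v : Vec (Fin n) k) → weight (λ _ _ → 1ℤ) es v ≡ 1ℤ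
  weight-one []       v = refl
  weight-one (e ∷ es) v = trans (ℤ.*-identityˡ _) (weight-one es v)

  Flat : Pattern 5 → Set
  Flat es = ∣ homs hadamard₂ es ∣ ℕ.≤ 2 ℕ.^ 4

  -- Each tensor factor saves 2 against the trivial bound. With `n = 2 ^ m` rows the savings
  -- multiply to n, which leaves n⁴ out of n⁵.
  flat-sylvester : ∀ es → Flat es → ∀ m → ∣ homs (sylvester m) es ∣ ℕ.≤ (2 ℕ.^ m) ℕ.^ 4
  flat-sylvester es p zero = ℕ.≤-reflexive (cong ∣_∣ (∑ᵛ-cong {1} 5 (weight-one es)))
  flat-sylvester es p (suc m) = begin
    ∣ homs (hadamard₂ ⊗ sylvester m) es ∣             ≡⟨ cong ∣_∣ (homs-⊗ hadamard₂ (sylvester m) es) ⟩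
    ∣ homs hadamard₂ es * homs (sylvester m) es ∣     ≡⟨ ℤ.abs-* (homs hadamard₂ es) _ ⟩
    ∣ homs hadamard₂ es ∣ ℕ.* ∣ homs (sylvester m) es ∣  ≤⟨ ℕ.*-mono-≤ p (flat-sylvester es p m) ⟩
    2 ℕ.^ 4 ℕ.* (2 ℕ.^ m) ℕ.^ 4                        ≡⟨ solve-2⁴ (2 ℕ.^ m) ⟨
    (2 ℕ.* 2 ℕ.^ m) ℕ.^ 4                              ∎
    where
    open ℕ.≤-Reasoning
    solve-2⁴ : ∀ n → 2 ℕ.* n ℕ.* (2 ℕ.* n ℕ.* (2 ℕ.* n ℕ.* (2 ℕ.* n ℕ.* 1))) ≡ 16 ℕ.* (n ℕ.* (n ℕ.* (n ℕ.* (n ℕ.* 1))))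
    solve-2⁴ = ℕ-Solver.solve-∀

  -- AllFlat d r: every edge set consisting of d and a subset of r is flat.
  AllFlat : Pattern 5 → Pattern 5 → Set
  AllFlat d []      = Flat d
  AllFlat d (e ∷ r) = AllFlat d r × AllFlat (e ∷ d) r

  allFlat? : ∀ d r → Dec (AllFlat d r)
  allFlat? d []      = _ ℕ.≤? _
  allFlat? d (e ∷ r) = allFlat? d r ×-dec allFlat? (e ∷ d) r

  NonemptyFlat : Pattern 5 → Set
  NonemptyFlat []      = ⊤
  NonemptyFlat (e ∷ r) = NonemptyFlat r × AllFlat (e ∷ []) r

  nonemptyFlat? : ∀ r → Dec (NonemptyFlat r)
  nonemptyFlat? []      = yes tt
  nonemptyFlat? (e ∷ r) = nonemptyFlat? r ×-dec allFlat? (e ∷ []) r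

  -- Expansion of the product over the edges

  shift : ∀ {n} → ℤ → (Fin n → Fin n → ℤ) → Fin n → Fin n → ℤ
  shift s W i j = 1ℤ + s * W i j

  -- An intermediate stage of the expansion: the edges in `d` have been assigned their term `W`,
  -- with `s` pulled out, while those in `r` still carry the full factor `1 + s * W`.
  mixed : ∀ {n k} → ℤ → (Fin n → Fin n → ℤ) → Pattern k → Pattern k → ℤ
  mixed {k = k} s W d r = ∑ᵛ k (λ v → weight W d v * weight (shift s W) r v)

  mixed-[] : ∀ {n k} s (W : Fin n → Fin n → ℤ) (d : Pattern k) → mixed s W d [] ≡ homs W d
  mixed-[] {k = k} s W d = ∑ᵛ-cong k (λ v → ℤ.*-identityʳ (weight W d v))

  -- In the factor of `e`, the summand 1 discards the edge and the summand `s * W` moves it to `d`.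
  mixed-∷ : ∀ {n k} s (W : Fin n → Fin n → ℤ) (d : Pattern k) e r → mixed s W d (e ∷ r) ≡ mixed s W d r + s * mixed s W (e ∷ d) r
  mixed-∷ {k = k} s W d e@(i , j) r = begin
    mixed s W d (e ∷ r)
      ≡⟨ ∑ᵛ-cong k (λ v → expand (weight W d v) s (W (lookup v i) (lookup v j)) (weight (shift s W) r v)) ⟩
    ∑ᵛ k (λ v → weight W d v * weight (shift s W) r v + s * (weight W (e ∷ d) v * weight (shift s W) r v))
      ≡⟨ ∑ᵛ-distrib-+ k _ _ ⟩
    mixed s W d r + ∑ᵛ k (λ v → s * (weight W (e ∷ d) v * weight (shift s W) r v))
      ≡⟨ cong (λ x → mixed s W d r + x) (*-distribˡ-∑ᵛ k s (λ v → weight W (e ∷ d) v * weight (shift s W) r v)) ⟨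
    mixed s W d r + s * mixed s W (e ∷ d) r  ∎
    where
    open ≡-Reasoning
    expand : ∀ d s w r → d * ((1ℤ + s * w) * r) ≡ d * r + s * ((w * d) * r)
    expand = solve-∀

  module _ {s : ℤ} (∣s∣≤1 : ∣ s ∣ ℕ.≤ 1) (m : ℕ) where

    private
      W = sylvester m
      n = 2 ℕ.^ m
      M : Pattern 5 → Pattern 5 → ℤ
      M = mixed s W

    double : ∀ l x → 2 ℕ.^ l ℕ.* x ℕ.+ 2 ℕ.^ l ℕ.* x ≡ 2 ℕ.^ suc l ℕ.* x
    double l x = trans (sym (ℕ.*-distribʳ-+ x (2 ℕ.^ l) (2 ℕ.^ l)))
      (cong (λ y → (2 ℕ.^ l ℕ.+ y) ℕ.* x) (sym (ℕ.+-identityʳ (2 ℕ.^ l))))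

    ∣s*x∣≤∣x∣ : ∀ x → ∣ s * x ∣ ℕ.≤ ∣ x ∣
    ∣s*x∣≤∣x∣ x = begin
      ∣ s * x ∣        ≡⟨ ℤ.abs-* s x ⟩
      ∣ s ∣ ℕ.* ∣ x ∣  ≤⟨ ℕ.*-monoˡ-≤ ∣ x ∣ ∣s∣≤1 ⟩
      1 ℕ.* ∣ x ∣      ≡⟨ ℕ.*-identityˡ ∣ x ∣ ⟩
      ∣ x ∣            ∎
      where open ℕ.≤-Reasoning

    -- `AllFlat` branches exactly as the expansion does. Each of its `2 ^ length r` leaves is at
    -- most n⁴, and the signs `s` do not increase absolute values.
    ∣mixed∣≤ : ∀ d r → AllFlat d r → ∣ M d r ∣ ℕ.≤ 2 ℕ.^ length r ℕ.* n ℕ.^ 4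
    ∣mixed∣≤ d [] p = begin
      ∣ M d [] ∣  ≡⟨ cong ∣_∣ (mixed-[] {k = 5} s W d) ⟩
      ∣ homs W d ∣        ≤⟨ flat-sylvester d p m ⟩
      n ℕ.^ 4             ≡⟨ ℕ.*-identityˡ (n ℕ.^ 4) ⟨
      1 ℕ.* n ℕ.^ 4       ∎
      where open ℕ.≤-Reasoning
    ∣mixed∣≤ d (e ∷ r) (p , q) = begin
      ∣ M d (e ∷ r) ∣                          ≡⟨ cong ∣_∣ (mixed-∷ s W d e r) ⟩
      ∣ M d r + s * M (e ∷ d) r ∣      ≤⟨ ℤ.∣i+j∣≤∣i∣+∣j∣ (M d r) _ ⟩
      ∣ M d r ∣ ℕ.+ ∣ s * M (e ∷ d) r ∣ ≤⟨ ℕ.+-mono-≤ (∣mixed∣≤ d r p) (ℕ.≤-trans (∣s*x∣≤∣x∣ _) (∣mixed∣≤ (e ∷ d) r q)) ⟩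
      2 ℕ.^ length r ℕ.* n ℕ.^ 4 ℕ.+ 2 ℕ.^ length r ℕ.* n ℕ.^ 4  ≡⟨ double (length r) (n ℕ.^ 4) ⟩
      2 ℕ.^ suc (length r) ℕ.* n ℕ.^ 4  ∎
      where open ℕ.≤-Reasoning

    -- Only the empty edge set contributes n⁵. All other terms branch off at their first chosen edge
    -- `e`, where the previous bound takes over. There are `2 ^ length r - 1` of them; rounding this
    -- up to a power of 2 keeps the induction simple.
    ∣mixed-[]∣≤ : ∀ r → NonemptyFlat r → ∣ M [] r ∣ ℕ.≤ n ℕ.^ 5 ℕ.+ 2 ℕ.^ length r ℕ.* n ℕ.^ 4
    ∣mixed-[]∣≤ [] p = begin
      ∣ M [] [] ∣  ≡⟨ cong ∣_∣ (trans (mixed-[] {k = 5} s W []) (∑ᵛ-one {n} 5)) ⟩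
      n ℕ.^ 5              ≤⟨ ℕ.m≤m+n _ _ ⟩
      n ℕ.^ 5 ℕ.+ _        ∎
      where open ℕ.≤-Reasoning
    ∣mixed-[]∣≤ (e ∷ r) (p , q) = begin
      ∣ M [] (e ∷ r) ∣                            ≡⟨ cong ∣_∣ (mixed-∷ s W [] e r) ⟩
      ∣ M [] r + s * M (e ∷ []) r ∣       ≤⟨ ℤ.∣i+j∣≤∣i∣+∣j∣ (M [] r) _ ⟩
      ∣ M [] r ∣ ℕ.+ ∣ s * M (e ∷ []) r ∣ ≤⟨ ℕ.+-mono-≤ (∣mixed-[]∣≤ r p) (ℕ.≤-trans (∣s*x∣≤∣x∣ _) (∣mixed∣≤ (e ∷ []) r q)) ⟩
      n ℕ.^ 5 ℕ.+ 2 ℕ.^ length r ℕ.* n ℕ.^ 4 ℕ.+ 2 ℕ.^ length r ℕ.* n ℕ.^ 4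
                                                          ≡⟨ ℕ.+-assoc (n ℕ.^ 5) _ _ ⟩
      n ℕ.^ 5 ℕ.+ (2 ℕ.^ length r ℕ.* n ℕ.^ 4 ℕ.+ 2 ℕ.^ length r ℕ.* n ℕ.^ 4)
                                                          ≡⟨ cong (n ℕ.^ 5 ℕ.+_) (double (length r) (n ℕ.^ 4)) ⟩
      n ℕ.^ 5 ℕ.+ 2 ℕ.^ suc (length r) ℕ.* n ℕ.^ 4        ∎
      where open ℕ.≤-Reasoning

  -- Verified by evaluation: there are 31 nonempty edge sets, each giving a sum of 32 signs.
  cycle₅-flat : NonemptyFlat cycle₅
  cycle₅-flat = toWitness {a? = nonemptyFlat? cycle₅} _

  banner-flat : NonemptyFlat banner
  banner-flat = toWitness {a? = nonemptyFlat? banner} _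

  -- The graph of a Sylvester matrix

  *-mono-≤-nonNeg : ∀ {a b c d} → 0ℤ ≤ a → a ≤ b → 0ℤ ≤ c → c ≤ d → a * c ≤ b * d
  *-mono-≤-nonNeg {a} {b} {c} {d} 0≤a a≤b 0≤c c≤d = ℤ.≤-trans
    (ℤ.*-monoʳ-≤-nonNeg c {{nonNegative 0≤c}} a≤b)
    (ℤ.*-monoˡ-≤-nonNeg b {{nonNegative (ℤ.≤-trans 0≤a a≤b)}} c≤d)

  0≤* : ∀ {a b} → 0ℤ ≤ a → 0ℤ ≤ b → 0ℤ ≤ a * b
  0≤* 0≤a 0≤b = *-mono-≤-nonNeg ℤ.≤-refl 0≤a ℤ.≤-refl 0≤b

  module _ {n : ℕ} {V : Fin n → Fin n → ℤ} (0≤V : ∀ i j → 0ℤ ≤ V i j) where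

    weight-nonNeg : ∀ {k} (es : Pattern k) v → 0ℤ ≤ weight V es v
    weight-nonNeg []             v = +≤+ z≤n
    weight-nonNeg ((i , j) ∷ es) v = 0≤* (0≤V _ _) (weight-nonNeg es v)

    weight-mono-≤ : ∀ {W} → (∀ i j → V i j ≤ W i j) → ∀ {k} (es : Pattern k) v → weight V es v ≤ weight W es v
    weight-mono-≤ V≤W []             v = ℤ.≤-refl
    weight-mono-≤ V≤W ((i , j) ∷ es) v =
      *-mono-≤-nonNeg (0≤V _ _) (V≤W _ _) (weight-nonNeg es v) (weight-mono-≤ V≤W es v)

  weight-scale : ∀ {n k} c (W : Fin n → Fin n → ℤ) (es : Pattern k) v →
    weight (λ i j → + c * W i j) es v ≡ + (c ℕ.^ length es) * weight W es v
  weight-scale c W []             v = refl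
  weight-scale c W ((i , j) ∷ es) v = begin
    + c * W _ _ * weight _ es v                          ≡⟨ cong (_*_ (+ c * W _ _)) (weight-scale c W es v) ⟩
    + c * W _ _ * (+ (c ℕ.^ length es) * weight W es v)  ≡⟨ interchange (+ c) (W _ _) (+ (c ℕ.^ length es)) _ ⟩
    + c * + (c ℕ.^ length es) * (W _ _ * weight W es v)  ≡⟨ cong (_* (W _ _ * weight W es v)) (ℤ.pos-* c (c ℕ.^ length es)) ⟨
    + (c ℕ.^ suc (length es)) * (W _ _ * weight W es v)  ∎
    where open ≡-Reasoning

  i≤+∣i∣ : ∀ i → i ≤ + ∣ i ∣
  i≤+∣i∣ (+ n)          = ℤ.≤-refl
  i≤+∣i∣ -[1+ n ] = -≤+

  -- Domination suffices because weights of nonnegative matrices are monotone in the entries.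
  -- Equality could not be asked for: an adjacency matrix vanishes on the diagonal, where
  -- `1 + s * W` may be 2.
  homs-bound : ∀ {s} m (V : Fin (2 ℕ.^ m) → Fin (2 ℕ.^ m) → ℤ) (es : Pattern 5) → NonemptyFlat es → ∣ s ∣ ℕ.≤ 1 →
    (∀ i j → 0ℤ ≤ V i j) → (∀ i j → + 2 * V i j ≤ shift s (sylvester m) i j) →
    + (2 ℕ.^ length es) * homs V es ≤ + ((2 ℕ.^ m) ℕ.^ 5 ℕ.+ 2 ℕ.^ length es ℕ.* (2 ℕ.^ m) ℕ.^ 4)
  homs-bound {s} m V es flat ∣s∣≤1 0≤V 2V≤ = begin
    + (2 ℕ.^ length es) * homs V es                         ≡⟨ *-distribˡ-∑ᵛ 5 (+ (2 ℕ.^ length es)) (weight V es) ⟩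
    ∑ᵛ 5 (λ v → + (2 ℕ.^ length es) * weight V es v)        ≡⟨ ∑ᵛ-cong 5 (weight-scale 2 V es) ⟨
    homs (λ i j → + 2 * V i j) es                           ≤⟨ ∑ᵛ-mono-≤ 5 (weight-mono-≤ (λ i j → 0≤* {+ 2} {V i j} (+≤+ z≤n) (0≤V i j)) 2V≤ es) ⟩
    homs (shift s (sylvester m)) es                         ≡⟨ ∑ᵛ-cong 5 (λ v → ℤ.*-identityˡ (weight (shift s (sylvester m)) es v)) ⟨
    mixed {k = 5} s (sylvester m) [] es                     ≤⟨ i≤+∣i∣ _ ⟩
    + ∣ mixed {k = 5} s (sylvester m) [] es ∣               ≤⟨ +≤+ (∣mixed-[]∣≤ {s} ∣s∣≤1 m es flat) ⟩
    _ ∎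
    where open ℤ.≤-Reasoning

  sylvester-±1 : ∀ m i j → sylvester m i j ≡ 1ℤ ⊎ sylvester m i j ≡ -1ℤ
  sylvester-±1 zero i j = inj₁ refl
  sylvester-±1 (suc m) i j
    with sylvester m (remainder {2} _ i) (remainder {2} _ j) | sylvester-±1 m (remainder {2} _ i) (remainder {2} _ j)
       | quotient {2} (2 ℕ.^ m) i | quotient {2} (2 ℕ.^ m) j
  ... | _ | inj₁ refl | 0F | _  = inj₁ refl
  ... | _ | inj₁ refl | 1F | 0F = inj₁ refl
  ... | _ | inj₁ refl | 1F | 1F = inj₂ refl
  ... | _ | inj₂ refl | 0F | _  = inj₂ refl
  ... | _ | inj₂ refl | 1F | 0F = inj₂ refl
  ... | _ | inj₂ refl | 1F | 1F = inj₁ refl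

  hadamard₂-sym : ∀ i j → hadamard₂ i j ≡ hadamard₂ j i
  hadamard₂-sym 0F 0F = refl
  hadamard₂-sym 0F 1F = refl
  hadamard₂-sym 1F 0F = refl
  hadamard₂-sym 1F 1F = refl

  sylvester-sym : ∀ m i j → sylvester m i j ≡ sylvester m j i
  sylvester-sym zero    i j = refl
  sylvester-sym (suc m) i j = cong₂ _*_ (hadamard₂-sym (quotient {2} (2 ℕ.^ m) i) (quotient (2 ℕ.^ m) j))
    (sylvester-sym m (remainder {2} (2 ℕ.^ m) i) (remainder {2} (2 ℕ.^ m) j))

  sylvesterGraph : ∀ m → Graph (2 ℕ.^ m)
  sylvesterGraph m = record { adj = a ; adj-sym = a-sym ; adj-irr = a-irr }
    where
    a : Fin (2 ℕ.^ m) → Fin (2 ℕ.^ m) → Bool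
    a i j = not (does (i Fin.≟ j)) ∧ does (sylvester m i j ≟ -1ℤ)
    a-irr : ∀ i → a i i ≡ false
    a-irr i with i Fin.≟ i
    ... | yes _ = refl
    ... | no ¬p = contradiction refl ¬p
    a-sym : ∀ i j → a i j ≡ a j i
    a-sym i j rewrite sylvester-sym m i j with i Fin.≟ j | j Fin.≟ i
    ... | yes _ | yes _ = refl
    ... | no  _ | no  _ = refl
    ... | yes p | no ¬p = contradiction (sym p) ¬p
    ... | no ¬p | yes p = contradiction (sym p) ¬p

  ι-nonNeg : ∀ b → 0ℤ ≤ ι b
  ι-nonNeg true  = +≤+ z≤n
  ι-nonNeg false = +≤+ z≤n

  -- Off the diagonal, 1 minus the entry is twice the indicator of the entry -1, so equality holds
  -- there. On the diagonal the left side is 0. For the complement the sign is `1ℤ` instead.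
  sylvesterGraph-adj : ∀ m i j → + 2 * adjℤ (sylvesterGraph m) i j ≤ shift -1ℤ (sylvester m) i j
  sylvesterGraph-adj m i j with i Fin.≟ j | sylvester m i j | sylvester-±1 m i j
  ... | yes _ | _ | inj₁ refl = +≤+ z≤n
  ... | yes _ | _ | inj₂ refl = +≤+ z≤n
  ... | no  _ | _ | inj₁ refl = +≤+ z≤n
  ... | no  _ | _ | inj₂ refl = ℤ.≤-refl

  adj-complement : ∀ {n} (G : Graph n) i j → adj (complement G) i j ≡ not (does (i Fin.≟ j)) ∧ not (adj G i j)
  adj-complement G i j with i Fin.≟ j
  ... | yes _ = refl
  ... | no  _ = refl

  sylvesterGraph-coadj : ∀ m i j → + 2 * adjℤ (complement (sylvesterGraph m)) i j ≤ shift 1ℤ (sylvester m) i j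
  sylvesterGraph-coadj m i j rewrite adj-complement (sylvesterGraph m) i j
    with i Fin.≟ j | sylvester m i j | sylvester-±1 m i j
  ... | yes _ | _ | inj₁ refl = +≤+ z≤n
  ... | yes _ | _ | inj₂ refl = +≤+ z≤n
  ... | no  _ | _ | inj₁ refl = ℤ.≤-refl
  ... | no  _ | _ | inj₂ refl = +≤+ z≤n

  hom-C5-sylvester : ∀ m → 32 ℕ.* hom C5 (sylvesterGraph m) ℕ.≤ (2 ℕ.^ m) ℕ.^ 5 ℕ.+ 32 ℕ.* (2 ℕ.^ m) ℕ.^ 4
  hom-C5-sylvester m = ℤ.drop‿+≤+ (begin
    + (32 ℕ.* hom C5 G)          ≡⟨ ℤ.pos-* 32 (hom C5 G) ⟩
    + 32 * + hom C5 G            ≡⟨ cong (_*_ (+ 32)) (+hom-C5 G) ⟩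
    + 32 * homs (adjℤ G) cycle₅  ≤⟨ homs-bound { -1ℤ } m (adjℤ G) cycle₅ cycle₅-flat (s≤s z≤n) (λ i j → ι-nonNeg _) (sylvesterGraph-adj m) ⟩
    _ ∎)
    where
    open ℤ.≤-Reasoning
    G = sylvesterGraph m

  hom-Banner-sylvester : ∀ m →
    32 ℕ.* hom Banner (complement (sylvesterGraph m)) ℕ.≤ (2 ℕ.^ m) ℕ.^ 5 ℕ.+ 32 ℕ.* (2 ℕ.^ m) ℕ.^ 4
  hom-Banner-sylvester m = ℤ.drop‿+≤+ (begin
    + (32 ℕ.* hom Banner G)      ≡⟨ ℤ.pos-* 32 (hom Banner G) ⟩
    + 32 * + hom Banner G        ≡⟨ cong (_*_ (+ 32)) (+hom-Banner G) ⟩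
    + 32 * homs (adjℤ G) banner  ≤⟨ homs-bound {1ℤ} m (adjℤ G) banner banner-flat (s≤s z≤n) (λ i j → ι-nonNeg _) (sylvesterGraph-coadj m) ⟩
    _ ∎)
    where
    open ℤ.≤-Reasoning
    G = complement (sylvesterGraph m)

  -- Counting in a graph and its complement

  ∑³ : ∀ {n} → (Fin n → Fin n → Fin n → ℤ) → ℤ
  ∑³ F = sum λ a → sum λ b → sum λ c → F a b c

  ∑⁵ : ∀ {n} → (Fin n → Fin n → Fin n → Fin n → Fin n → ℤ) → ℤ
  ∑⁵ F = sum λ a → sum λ b → sum λ c → sum λ d → sum λ e → F a b c d e

  uncurry³ : ∀ {n} → (Fin n → Fin n → Fin n → ℤ) → Vec (Fin n) 3 → ℤ
  uncurry³ F (a ∷ b ∷ c ∷ []) = F a b c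

  uncurry⁵ : ∀ {n} → (Fin n → Fin n → Fin n → Fin n → Fin n → ℤ) → Vec (Fin n) 5 → ℤ
  uncurry⁵ F (a ∷ b ∷ c ∷ d ∷ e ∷ []) = F a b c d e

  ∑³-+ : ∀ {n} (F G : Fin n → Fin n → Fin n → ℤ) → ∑³ (λ a b c → F a b c + G a b c) ≡ ∑³ F + ∑³ G
  ∑³-+ F G = ∑ᵛ-distrib-+ 3 (uncurry³ F) (uncurry³ G)

  ∑⁵-+ : ∀ {n} (F G : Fin n → Fin n → Fin n → Fin n → Fin n → ℤ) →
    ∑⁵ (λ a b c d e → F a b c d e + G a b c d e) ≡ ∑⁵ F + ∑⁵ G
  ∑⁵-+ F G = ∑ᵛ-distrib-+ 5 (uncurry⁵ F) (uncurry⁵ G)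

  ∑⁵-* : ∀ {n} x (F : Fin n → Fin n → Fin n → Fin n → Fin n → ℤ) →
    x * ∑⁵ F ≡ ∑⁵ (λ a b c d e → x * F a b c d e)
  ∑⁵-* x F = *-distribˡ-∑ᵛ 5 x (uncurry⁵ F)

  0≤sum : ∀ {n} {f : Fin n → ℤ} → (∀ i → 0ℤ ≤ f i) → 0ℤ ≤ sum f
  0≤sum {zero}  p = ℤ.≤-refl
  0≤sum {suc n} p = ℤ.+-mono-≤ (p zero) (0≤sum (p ∘ suc))

  0≤x*x : ∀ x → 0ℤ ≤ x * x
  0≤x*x (+ n)    = subst (0ℤ ≤_) (ℤ.pos-* n n) (+≤+ z≤n)
  0≤x*x -[1+ n ] = +≤+ z≤n

  -- Even edge sets of the 5-cycle

  rotate : ∀ {n} → (Fin n → Fin n → Fin n → Fin n → Fin n → ℤ) → Fin n → Fin n → Fin n → Fin n → Fin n → ℤ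
  rotate F a b c d e = F b c d e a

  -- Four exchanges of neighbouring sums carry the sum over `a` to the innermost place.
  ∑⁵-rotate : ∀ {n} (F : Fin n → Fin n → Fin n → Fin n → Fin n → ℤ) → ∑⁵ (rotate F) ≡ ∑⁵ F
  ∑⁵-rotate F =
    trans (∑-comm λ a b → sum λ c → sum λ d → sum λ e → F b c d e a) (sum-cong-≗ λ b →
    trans (∑-comm λ a c → sum λ d → sum λ e → F b c d e a) (sum-cong-≗ λ c →
    trans (∑-comm λ a d → sum λ e → F b c d e a) (sum-cong-≗ λ d →
    ∑-comm λ a e → F b c d e a)))

  cyclicSum : ∀ {n} → (Fin n → Fin n → Fin n → Fin n → Fin n → ℤ) → Fin n → Fin n → Fin n → Fin n → Fin n → ℤ
  cyclicSum F a b c d e = F a b c d e + (F b c d e a + (F c d e a b + (F d e a b c + F e a b c d)))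

  ∑⁵-cyclicSum : ∀ {n} (F : Fin n → Fin n → Fin n → Fin n → Fin n → ℤ) → ∑⁵ (cyclicSum F) ≡ + 5 * ∑⁵ F
  ∑⁵-cyclicSum F = trans
    (trans (∑⁵-+ F _) (cong (_+_ (∑⁵ F))
      (trans (∑⁵-+ F₁ _) (cong₂ _+_ r₁
        (trans (∑⁵-+ F₂ _) (cong₂ _+_ r₂
          (trans (∑⁵-+ F₃ F₄) (cong₂ _+_ r₃ r₄))))))))
    (fivefold (∑⁵ F))
    where
    F₁ = rotate F
    F₂ = rotate F₁
    F₃ = rotate F₂
    F₄ = rotate F₃
    r₁ = ∑⁵-rotate F
    r₂ = trans (∑⁵-rotate F₁) r₁
    r₃ = trans (∑⁵-rotate F₂) r₂
    r₄ = trans (∑⁵-rotate F₃) r₃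
    fivefold : ∀ x → x + (x + (x + (x + x))) ≡ + 5 * x
    fivefold = solve-∀

  -- For fixed `a` the pairs `b`, `c` and `e`, `d` range independently, so the inner sum is the
  -- square of `S a`. The second factor reads the cycle from `a` in the opposite direction.
  ∑⁵-square-nonNeg : ∀ {n} (X : Fin n → Fin n → Fin n → ℤ) → 0ℤ ≤ ∑⁵ (λ a b c d e → X a b c * X a e d)
  ∑⁵-square-nonNeg X = 0≤sum λ a → ℤ.≤-trans (0≤x*x (S a)) (ℤ.≤-reflexive (sym (square a)))
    where
    S : _ → ℤ
    S a = sum λ b → sum λ c → X a b c
    square : ∀ a → (sum λ b → sum λ c → sum λ d → sum λ e → X a b c * X a e d) ≡ S a * S a
    square a = begin
      (sum λ b → sum λ c → sum λ d → sum λ e → X a b c * X a e d)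
        ≡⟨ sum-cong-≗ (λ b → sum-cong-≗ λ c → trans (sum-cong-≗ λ d → sym (*-distribˡ-sum (X a b c) λ e → X a e d))
             (sym (*-distribˡ-sum (X a b c) λ d → sum λ e → X a e d))) ⟩
      (sum λ b → sum λ c → X a b c * (sum λ d → sum λ e → X a e d))
        ≡⟨ sum-cong-≗ (λ b → sym (*-distribʳ-sum (sum λ d → sum λ e → X a e d) (X a b))) ⟩
      (sum λ b → sum (X a b) * (sum λ d → sum λ e → X a e d))
        ≡⟨ sym (*-distribʳ-sum (sum λ d → sum λ e → X a e d) (λ b → sum (X a b))) ⟩
      S a * (sum λ d → sum λ e → X a e d)
        ≡⟨ cong (_*_ (S a)) (∑-comm λ d e → X a e d) ⟩
      S a * S a ∎
      where open ≡-Reasoning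

  module _ {n : ℕ} (U : Fin n → Fin n → ℤ) (U-sym : ∀ i j → U i j ≡ U j i) where

    -- The even part of ∏ (1 + u) over the edges of the 5-cycle is 1 plus the cyclic sum of this polynomial.
    evenPart : Fin n → Fin n → Fin n → Fin n → Fin n → ℤ
    evenPart a b c d e = U a b * U e a + (U b c * U d e + (U a b * U b c) * (U e a * U d e))

    -- After reorienting edges by symmetry, each of the three terms is a function of `a`, `b`, `c`
    -- times its mirror image under the reflection of the cycle that fixes `a`.
    ∑⁵-evenPart-nonNeg : 0ℤ ≤ ∑⁵ evenPart
    ∑⁵-evenPart-nonNeg = subst (0ℤ ≤_) (sym split)
      (ℤ.+-mono-≤ (∑⁵-square-nonNeg λ a b c → U a b)
        (ℤ.+-mono-≤ (∑⁵-square-nonNeg λ a b c → U b c) (∑⁵-square-nonNeg λ a b c → U a b * U b c)))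
      where
      split : ∑⁵ evenPart ≡ ∑⁵ (λ a b c d e → U a b * U a e) +
        (∑⁵ (λ a b c d e → U b c * U e d) + ∑⁵ (λ a b c d e → (U a b * U b c) * (U a e * U e d)))
      split = trans
        (sum-cong₅ λ a b c d e → cong₂ (λ x y → U a b * x + (U b c * y + (U a b * U b c) * (x * y))) (U-sym e a) (U-sym d e))
        (trans (∑⁵-+ (λ a b c d e → U a b * U a e) _)
          (cong (_+_ (∑⁵ λ a b c d e → U a b * U a e)) (∑⁵-+ (λ a b c d e → U b c * U e d) _)))

    -- Adding the two signs cancels the odd terms and doubles the even ones. The 15 nonempty even
    -- edge sets are 5 adjacent pairs, 5 disjoint pairs and 5 paths with four edges; each class is
    -- one orbit under rotation, represented by one term of `evenPart`.
    weight-cycle₅-even : ∀ a b c d e → let v = a ∷ b ∷ c ∷ d ∷ e ∷ [] in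
      weight (shift 1ℤ U) cycle₅ v + weight (shift -1ℤ U) cycle₅ v ≡ + 2 * (1ℤ + cyclicSum evenPart a b c d e)
    weight-cycle₅-even a b c d e = expand (U a b) (U b c) (U c d) (U d e) (U e a)
      where
      expand : ∀ x y z u w →
        (1ℤ + 1ℤ * u) * ((1ℤ + 1ℤ * w) * ((1ℤ + 1ℤ * z) * ((1ℤ + 1ℤ * y) * ((1ℤ + 1ℤ * x) * 1ℤ)))) +
        (1ℤ + -1ℤ * u) * ((1ℤ + -1ℤ * w) * ((1ℤ + -1ℤ * z) * ((1ℤ + -1ℤ * y) * ((1ℤ + -1ℤ * x) * 1ℤ)))) ≡
        + 2 * (1ℤ + ((x * w + (y * u + (x * y) * (w * u))) + ((y * x + (z * w + (y * z) * (x * w))) +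
          ((z * y + (u * x + (z * u) * (y * x))) + ((u * z + (w * y + (u * w) * (z * y))) +
          (w * u + (x * z + (w * x) * (u * z))))))))
      expand = solve-∀

    homs-cycle₅-even : + 2 * + (n ℕ.^ 5) ≤ homs (shift 1ℤ U) cycle₅ + homs (shift -1ℤ U) cycle₅
    homs-cycle₅-even = begin
      + 2 * + (n ℕ.^ 5)
        ≤⟨ ℤ.*-monoˡ-≤-nonNeg (+ 2) (ℤ.≤-trans (ℤ.≤-reflexive (sym (ℤ.+-identityʳ _)))
             (ℤ.+-monoʳ-≤ (+ (n ℕ.^ 5)) (0≤* {+ 5} (+≤+ z≤n) ∑⁵-evenPart-nonNeg))) ⟩
      + 2 * (+ (n ℕ.^ 5) + + 5 * ∑⁵ evenPart)
        ≡⟨ cong₂ (λ x y → + 2 * (x + y)) (∑ᵛ-one {n} 5) (∑⁵-cyclicSum evenPart) ⟨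
      + 2 * (∑⁵ {n} (λ _ _ _ _ _ → 1ℤ) + ∑⁵ (cyclicSum evenPart))
        ≡⟨ cong (_*_ (+ 2)) (∑⁵-+ (λ _ _ _ _ _ → 1ℤ) (cyclicSum evenPart)) ⟨
      + 2 * ∑⁵ (λ a b c d e → 1ℤ + cyclicSum evenPart a b c d e)
        ≡⟨ ∑⁵-* (+ 2) (λ a b c d e → 1ℤ + cyclicSum evenPart a b c d e) ⟩
      ∑⁵ (λ a b c d e → + 2 * (1ℤ + cyclicSum evenPart a b c d e))
        ≡⟨ sum-cong₅ weight-cycle₅-even ⟨
      ∑⁵ (λ a b c d e → weight (shift 1ℤ U) cycle₅ (a ∷ b ∷ c ∷ d ∷ e ∷ []) + weight (shift -1ℤ U) cycle₅ (a ∷ b ∷ c ∷ d ∷ e ∷ []))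
        ≡⟨ ∑ᵛ-distrib-+ 5 (weight (shift 1ℤ U) cycle₅) (weight (shift -1ℤ U) cycle₅) ⟩
      homs (shift 1ℤ U) cycle₅ + homs (shift -1ℤ U) cycle₅ ∎
      where open ℤ.≤-Reasoning

  -- Banners versus 5-cycles

  ∑⁵-factor : ∀ {n} (w : Fin n → Fin n → ℤ) (p q : Fin n → Fin n → Fin n → Fin n → ℤ) →
    ∑⁵ (λ a b c d e → w a e * (p a e c b * q a e c d)) ≡ ∑³ (λ a e c → w a e * (sum (p a e c) * sum (q a e c)))
  ∑⁵-factor w p q = sum-cong-≗ λ a → begin
    (sum λ b → sum λ c → sum λ d → sum λ e → F a b c d e)
      ≡⟨ (sum-cong-≗ λ b → trans (sum-cong-≗ λ c → ∑-comm λ d e → F a b c d e) (∑-comm λ c e → sum λ d → F a b c d e)) ⟩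
    (sum λ b → sum λ e → sum λ c → sum λ d → F a b c d e)
      ≡⟨ ∑-comm (λ b e → sum λ c → sum λ d → F a b c d e) ⟩
    (sum λ e → sum λ b → sum λ c → sum λ d → F a b c d e)
      ≡⟨ (sum-cong-≗ λ e → ∑-comm λ b c → sum λ d → F a b c d e) ⟩
    (sum λ e → sum λ c → sum λ b → sum λ d → F a b c d e)
      -- With `a`, `e`, `c` fixed outside, `b` and `d` occur in separate factors, so their sums
      -- split.
      ≡⟨ (sum-cong-≗ λ e → sum-cong-≗ λ c → factor a e c) ⟩
    (sum λ e → sum λ c → w a e * (sum (p a e c) * sum (q a e c))) ∎
    where
    open ≡-Reasoning
    F : _ → _ → _ → _ → _ → ℤ
    F a b c d e = w a e * (p a e c b * q a e c d)
    factor : ∀ a e c → (sum λ b → sum λ d → F a b c d e) ≡ w a e * (sum (p a e c) * sum (q a e c))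
    factor a e c = trans (sum-cong-≗ λ b → sym (*-distribˡ-sum (w a e) λ d → p a e c b * q a e c d))
      (trans (sym (*-distribˡ-sum (w a e) λ b → sum λ d → p a e c b * q a e c d))
        (cong (_*_ (w a e)) (sum-*-sum (p a e c) (q a e c))))

  ∑³-mono-≤ : ∀ {n} {F G : Fin n → Fin n → Fin n → ℤ} → (∀ a b c → F a b c ≤ G a b c) → ∑³ F ≤ ∑³ G
  ∑³-mono-≤ p = sum-mono-≤ λ a → sum-mono-≤ λ b → sum-mono-≤ λ c → p a b c

  module _ {n : ℕ} (W : Fin n → Fin n → ℤ) (W-sym : ∀ i j → W i j ≡ W j i) (0≤W : ∀ i j → 0ℤ ≤ W i j) where

    walk₂ : Fin n → Fin n → ℤ
    walk₂ a c = sum λ b → W a b * W b c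

    -- Besides the edge `a e`, the cycle consists of the walks `a b c` and `e d c`.
    homs-cycle₅-walk₂ : homs W cycle₅ ≡ ∑³ (λ a e c → W a e * (walk₂ a c * walk₂ e c))
    homs-cycle₅-walk₂ = trans (sum-cong₅ pointwise)
      (∑⁵-factor W (λ a e c b → W a b * W b c) (λ a e c d → W e d * W d c))
      where
      pointwise : ∀ a b c d e → weight W cycle₅ (a ∷ b ∷ c ∷ d ∷ e ∷ []) ≡ W a e * ((W a b * W b c) * (W e d * W d c))
      pointwise a b c d e rewrite W-sym e a | W-sym d e | W-sym c d = reorder (W e d) (W a e) (W d c) (W b c) (W a b)
        where
        reorder : ∀ x y z u w → x * (y * (z * (u * (w * 1ℤ)))) ≡ y * ((w * u) * (x * z))
        reorder = solve-∀

    -- Here `a` is the pendant vertex, and the 4-cycle consists of two walks from `e` to `c`, with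
    -- midpoints `b` and `d`.
    homs-banner-walk₂ : homs W banner ≡ ∑³ (λ a e c → W a e * (walk₂ e c * walk₂ e c))
    homs-banner-walk₂ = trans (sum-cong₅ pointwise)
      (∑⁵-factor W (λ a e c b → W e b * W b c) (λ a e c d → W e d * W d c))
      where
      pointwise : ∀ a b c d e → weight W banner (a ∷ b ∷ c ∷ d ∷ e ∷ []) ≡ W a e * ((W e b * W b c) * (W e d * W d c))
      pointwise a b c d e rewrite W-sym e a | W-sym c b = reorder (W e d) (W e b) (W a e) (W d c) (W b c)
        where
        reorder : ∀ x y z u w → x * (y * (z * (u * (w * 1ℤ)))) ≡ z * ((y * w) * (x * u))
        reorder = solve-∀

    -- Exchanges the roles of the two ends of the pendant edge. The two forms supply the two squares
    -- in the estimate that follows.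
    homs-banner-walk₂′ : homs W banner ≡ ∑³ (λ a e c → W a e * (walk₂ a c * walk₂ a c))
    homs-banner-walk₂′ = trans homs-banner-walk₂
      (trans (∑-comm λ a e → sum λ c → W a e * (walk₂ e c * walk₂ e c))
        (sum-cong-≗ λ e → sum-cong-≗ λ a → sum-cong-≗ λ c → cong (_* (walk₂ e c * walk₂ e c)) (W-sym a e)))

    -- 2xy ≤ x² + y² for the numbers x, y of walks of length two from the two ends of an edge to a common vertex.
    homs-cycle₅≤homs-banner : homs W cycle₅ ≤ homs W banner
    homs-cycle₅≤homs-banner = ℤ.*-cancelˡ-≤-pos (homs W cycle₅) (homs W banner) (+ 2) (begin
      + 2 * homs W cycle₅
        ≡⟨ 2* (homs W cycle₅) ⟩
      homs W cycle₅ + homs W cycle₅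
        ≡⟨ cong₂ _+_ homs-cycle₅-walk₂ homs-cycle₅-walk₂ ⟩
      ∑³ C + ∑³ C
        ≡⟨ ∑³-+ C C ⟨
      ∑³ (λ a e c → C a e c + C a e c)
        ≤⟨ ∑³-mono-≤ (λ a e c → amgm (0≤W a e) (walk₂ a c) (walk₂ e c)) ⟩
      ∑³ (λ a e c → W a e * (walk₂ a c * walk₂ a c) + W a e * (walk₂ e c * walk₂ e c))
        ≡⟨ ∑³-+ (λ a e c → W a e * (walk₂ a c * walk₂ a c)) (λ a e c → W a e * (walk₂ e c * walk₂ e c)) ⟩
      ∑³ (λ a e c → W a e * (walk₂ a c * walk₂ a c)) + ∑³ (λ a e c → W a e * (walk₂ e c * walk₂ e c))
        ≡⟨ cong₂ _+_ homs-banner-walk₂′ homs-banner-walk₂ ⟨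
      homs W banner + homs W banner
        ≡⟨ 2* (homs W banner) ⟨
      + 2 * homs W banner ∎)
      where
      open ℤ.≤-Reasoning
      C : Fin n → Fin n → Fin n → ℤ
      C a e c = W a e * (walk₂ a c * walk₂ e c)
      2* : ∀ x → + 2 * x ≡ x + x
      2* = solve-∀
      square : ∀ w x y → w * (x * x) + w * (y * y) - (w * (x * y) + w * (x * y)) ≡ w * ((x - y) * (x - y))
      square = solve-∀
      amgm : ∀ {w} → 0ℤ ≤ w → ∀ x y → w * (x * y) + w * (x * y) ≤ w * (x * x) + w * (y * y)
      amgm {w} 0≤w x y = ℤ.0≤i-j⇒j≤i (subst (0ℤ ≤_) (sym (square w x y)) (0≤* 0≤w (0≤x*x (x - y))))

  -- The error caused by loops

  δ : ∀ {n} → Fin n → Fin n → ℤ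
  δ i j = ι (does (i Fin.≟ j))

  sum-δ : ∀ {n} (i : Fin n) → sum (δ i) ≡ 1ℤ
  sum-δ {suc n} zero    = trans (cong (_+_ 1ℤ) (sum-const n 0ℤ)) (cong (_+_ 1ℤ) (ℤ.*-zeroʳ (+ n)))
  sum-δ         (suc i) = trans (ℤ.+-identityˡ _) (sum-δ i)

  coincidences : ∀ {n k} → Pattern k → Vec (Fin n) k → ℤ
  coincidences []             v = 0ℤ
  coincidences ((i , j) ∷ es) v = δ (lookup v i) (lookup v j) + coincidences es v

  coincidences-nonNeg : ∀ {n k} (es : Pattern k) (v : Vec (Fin n) k) → 0ℤ ≤ coincidences es v
  coincidences-nonNeg []             v = ℤ.≤-refl
  coincidences-nonNeg ((i , j) ∷ es) v = ℤ.+-mono-≤ (ι-nonNeg (does (lookup v i Fin.≟ lookup v j))) (coincidences-nonNeg es v)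

  ι≤1 : ∀ b → ι b ≤ 1ℤ
  ι≤1 true  = ℤ.≤-refl
  ι≤1 false = +≤+ z≤n

  module _ {n : ℕ} (G : Graph n) where

    private
      L W : Fin n → Fin n → ℤ
      L i j = ι (not (adj G i j))
      W     = adjℤ (complement G)

    nonadj-dichotomy : ∀ i j → L i j ≡ W i j ⊎ δ i j ≡ 1ℤ
    nonadj-dichotomy i j rewrite adj-complement G i j with i Fin.≟ j
    ... | yes _ = inj₂ refl
    ... | no  _ = inj₁ refl

    weight-L≤1 : ∀ {k} (es : Pattern k) v → weight L es v ≤ 1ℤ
    weight-L≤1 es v = ℤ.≤-trans (weight-mono-≤ (λ i j → ι-nonNeg (not (adj G i j))) (λ i j → ι≤1 (not (adj G i j))) es v)
      (ℤ.≤-reflexive (weight-one es v))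

    -- `L` has ones on the diagonal and `W` has zeros. If the first edge is not collapsed, `L` and
    -- `W` agree on it and the inductive bound is multiplied by a number between 0 and 1. If it is
    -- collapsed, its coincidence alone pays for the left side, which is at most 1.
    weight-loops : ∀ {k} (es : Pattern k) v → weight L es v ≤ weight W es v + coincidences es v
    weight-loops []             v = ℤ.≤-refl
    weight-loops ((i , j) ∷ es) v with nonadj-dichotomy (lookup v i) (lookup v j)
    ... | inj₁ L≡W = begin
      L x y * weight L es v                                  ≡⟨ cong (_* weight L es v) L≡W ⟩
      W x y * weight L es v                                  ≤⟨ ℤ.*-monoˡ-≤-nonNeg (W x y) {{nonNegative (ι-nonNeg (adj (complement G) x y))}} (weight-loops es v) ⟩
      W x y * (weight W es v + coincidences es v)            ≡⟨ ℤ.*-distribˡ-+ (W x y) (weight W es v) _ ⟩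
      W x y * weight W es v + W x y * coincidences es v      ≤⟨ ℤ.+-monoʳ-≤ (W x y * weight W es v) Wc≤ ⟩
      W x y * weight W es v + (δ x y + coincidences es v)    ∎
      where
      open ℤ.≤-Reasoning
      x = lookup v i
      y = lookup v j
      c = coincidences es v
      Wc≤ : W x y * c ≤ δ x y + c
      Wc≤ = ℤ.≤-trans (ℤ.*-monoʳ-≤-nonNeg c {{nonNegative (coincidences-nonNeg es v)}} (ι≤1 (adj (complement G) x y)))
        (ℤ.≤-trans (ℤ.≤-reflexive (trans (ℤ.*-identityˡ c) (sym (ℤ.+-identityˡ c)))) (ℤ.+-monoˡ-≤ c (ι-nonNeg (does (x Fin.≟ y)))))
    ... | inj₂ δ≡1 = begin
      weight L ((i , j) ∷ es) v                              ≤⟨ weight-L≤1 ((i , j) ∷ es) v ⟩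
      1ℤ                                                     ≡⟨ δ≡1 ⟨
      δ x y                                                  ≡⟨ ℤ.+-identityʳ (δ x y) ⟨
      δ x y + 0ℤ                                             ≤⟨ ℤ.+-monoʳ-≤ (δ x y) (coincidences-nonNeg es v) ⟩
      δ x y + coincidences es v                              ≡⟨ ℤ.+-identityˡ _ ⟨
      0ℤ + (δ x y + coincidences es v)                       ≤⟨ ℤ.+-monoˡ-≤ _ (weight-nonNeg (λ i j → ι-nonNeg (adj (complement G) i j)) ((i , j) ∷ es) v) ⟩
      weight W ((i , j) ∷ es) v + (δ x y + coincidences es v) ∎
      where
      open ℤ.≤-Reasoning
      x = lookup v i
      y = lookup v j

  -- Each of the five edges is collapsed by n⁴ maps, and by rotation it is enough to count for one
  -- edge.
  ∑⁵-coincidences : ∀ {n} → ∑ᵛ {n} 5 (coincidences cycle₅) ≡ + 5 * + (n ℕ.^ 4)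
  ∑⁵-coincidences {n} = trans (sum-cong₅ pointwise) (trans (∑⁵-cyclicSum F) (cong (_*_ (+ 5)) ∑F))
    where
    F : Fin n → Fin n → Fin n → Fin n → Fin n → ℤ
    -- The edge `d e` is chosen because its innermost sum is directly `sum-δ`.
    F a b c d e = δ d e
    reorder : ∀ x y z u w → x + (y + (z + (u + (w + 0ℤ)))) ≡ x + (y + (w + (u + z)))
    reorder = solve-∀
    pointwise : ∀ a b c d e → coincidences cycle₅ (a ∷ b ∷ c ∷ d ∷ e ∷ []) ≡ cyclicSum F a b c d e
    pointwise a b c d e = reorder (δ d e) (δ e a) (δ c d) (δ b c) (δ a b)
    ∑F : ∑⁵ F ≡ + (n ℕ.^ 4)
    ∑F = trans ∑δ (∑ᵛ-one {n} 4)
      where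
      ∑δ : ∑⁵ F ≡ ∑ᵛ {n} 4 (λ _ → 1ℤ)
      ∑δ = sum-cong-≗ {n} λ a → sum-cong-≗ {n} λ b → sum-cong-≗ {n} λ c → sum-cong-≗ {n} sum-δ

  homs-nonadj≤ : ∀ {n} (G : Graph n) →
    homs (λ i j → ι (not (adj G i j))) cycle₅ ≤ homs (adjℤ (complement G)) cycle₅ + + 5 * + (n ℕ.^ 4)
  homs-nonadj≤ {n} G = begin
    homs (λ i j → ι (not (adj G i j))) cycle₅                         ≤⟨ ∑ᵛ-mono-≤ {n} 5 (weight-loops G cycle₅) ⟩
    ∑ᵛ 5 (λ v → weight W cycle₅ v + coincidences cycle₅ v)            ≡⟨ ∑ᵛ-distrib-+ 5 (weight W cycle₅) (coincidences cycle₅) ⟩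
    homs W cycle₅ + ∑ᵛ {n} 5 (coincidences cycle₅)                        ≡⟨ cong (_+_ (homs W cycle₅)) (∑⁵-coincidences {n}) ⟩
    homs W cycle₅ + + 5 * + (n ℕ.^ 4)                                 ∎
    where
    open ℤ.≤-Reasoning
    W = adjℤ (complement G)

  -- The lower bound on counts

  weight-cong : ∀ {n k} {V W : Fin n → Fin n → ℤ} → (∀ i j → V i j ≡ W i j) → ∀ (es : Pattern k) v → weight V es v ≡ weight W es v
  weight-cong p []             v = refl
  weight-cong p ((i , j) ∷ es) v = cong₂ _*_ (p _ _) (weight-cong p es v)

  homs-double : ∀ {n} {V W : Fin n → Fin n → ℤ} → (∀ i j → V i j ≡ + 2 * W i j) → homs V cycle₅ ≡ + 32 * homs W cycle₅
  homs-double {V = V} {W} p = trans (∑ᵛ-cong 5 (λ v → trans (weight-cong p cycle₅ v) (weight-scale 2 W cycle₅ v)))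
    (sym (*-distribˡ-∑ᵛ 5 (+ 32) (weight W cycle₅)))

  -- Take `U` to be twice the adjacency matrix minus 1. Then `1 + U` and `1 - U` are twice the
  -- indicators of adjacency and of nonadjacency, loops included, and the five edges yield the
  -- factor 32. Removing loops costs 5 n⁴, the 5-cycles of the complement are then replaced by
  -- banners, and halving gives 16 and 80 = 16 · 5.
  n^5≤16homs+80n^4 : ∀ {n} (G : Graph n) → n ℕ.^ 5 ℕ.≤ 16 ℕ.* (hom C5 G ℕ.+ hom Banner (complement G)) ℕ.+ 80 ℕ.* n ℕ.^ 4
  n^5≤16homs+80n^4 {n} G = ℤ.drop‿+≤+ (ℤ.*-cancelˡ-≤-pos (+ (n ℕ.^ 5)) _ (+ 2) (begin
    + 2 * + (n ℕ.^ 5)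
      ≤⟨ homs-cycle₅-even U U-sym ⟩
    homs (shift 1ℤ U) cycle₅ + homs (shift -1ℤ U) cycle₅
      ≡⟨ cong₂ _+_ (homs-double (λ i j → U-adj (adj G i j))) (homs-double (λ i j → U-nonadj (adj G i j))) ⟩
    + 32 * homs (adjℤ G) cycle₅ + + 32 * homs (λ i j → ι (not (adj G i j))) cycle₅
      ≤⟨ ℤ.+-monoʳ-≤ (+ 32 * homs (adjℤ G) cycle₅) (ℤ.*-monoˡ-≤-nonNeg (+ 32) (ℤ.≤-trans (homs-nonadj≤ G)
           (ℤ.+-monoˡ-≤ (+ 5 * + (n ℕ.^ 4)) (homs-cycle₅≤homs-banner (adjℤ (complement G))
             (λ i j → cong ι (adj-sym (complement G) i j)) (λ i j → ι-nonNeg (adj (complement G) i j)))))) ⟩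
    + 32 * homs (adjℤ G) cycle₅ + + 32 * (homs (adjℤ (complement G)) banner + + 5 * + (n ℕ.^ 4))
      ≡⟨ cong₂ (λ x y → + 32 * x + + 32 * (y + + 5 * + (n ℕ.^ 4))) (+hom-C5 G) (+hom-Banner (complement G)) ⟨
    + 32 * + h₁ + + 32 * (+ h₂ + + 5 * + (n ℕ.^ 4))
      ≡⟨ collect (+ h₁) (+ h₂) (+ (n ℕ.^ 4)) ⟩
    + 2 * (+ 16 * (+ h₁ + + h₂) + + 80 * + (n ℕ.^ 4))
      ≡⟨ cong₂ (λ x y → + 2 * (x + y)) (trans (ℤ.pos-* 16 (h₁ ℕ.+ h₂)) (cong (_*_ (+ 16)) (ℤ.pos-+ h₁ h₂))) (ℤ.pos-* 80 (n ℕ.^ 4)) ⟨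
    + 2 * (+ (16 ℕ.* (h₁ ℕ.+ h₂)) + + (80 ℕ.* n ℕ.^ 4))
      ≡⟨ cong (_*_ (+ 2)) (ℤ.pos-+ (16 ℕ.* (h₁ ℕ.+ h₂)) (80 ℕ.* n ℕ.^ 4)) ⟨
    + 2 * + (16 ℕ.* (h₁ ℕ.+ h₂) ℕ.+ 80 ℕ.* n ℕ.^ 4) ∎))
    where
    open ℤ.≤-Reasoning
    h₁ = hom C5 G
    h₂ = hom Banner (complement G)
    U : Fin n → Fin n → ℤ
    U i j = + 2 * adjℤ G i j - 1ℤ
    U-sym : ∀ i j → U i j ≡ U j i
    U-sym i j = cong (λ b → + 2 * ι b - 1ℤ) (adj-sym G i j)
    U-adj : ∀ b → 1ℤ + 1ℤ * (+ 2 * ι b - 1ℤ) ≡ + 2 * ι b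
    U-adj true  = refl
    U-adj false = refl
    U-nonadj : ∀ b → 1ℤ + -1ℤ * (+ 2 * ι b - 1ℤ) ≡ + 2 * ι (not b)
    U-nonadj true  = refl
    U-nonadj false = refl
    collect : ∀ x y z → + 32 * x + + 32 * (y + + 5 * z) ≡ + 2 * (+ 16 * (x + y) + + 80 * z)
    collect = solve-∀

module Limits where

  open Counting
  open import Data.Rational using (_≤_; _<_; _+_; _-_; _*_; -_; nonNegative; positive)
  open ℚ-Solver.+-*-Solver using (solve; con; _:+_; _:*_; _:-_; _:=_)

  -- Natural numbers as rationals

  fromℕ : ℕ → ℚ
  fromℕ n = + n / 1

  toℚᵘ-fromℕ : ∀ n → toℚᵘ (fromℕ n) ℚᵘ.≃ mkℚᵘ (+ n) 0
  toℚᵘ-fromℕ n = ℚ.toℚᵘ-fromℚᵘ (mkℚᵘ (+ n) 0)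

  fromℕ-mono-≤ : ∀ {m n} → m ℕ.≤ n → fromℕ m ≤ fromℕ n
  fromℕ-mono-≤ {m} {n} m≤n = ℚ.toℚᵘ-cancel-≤ (begin
    toℚᵘ (fromℕ m)  ≃⟨ toℚᵘ-fromℕ m ⟩
    mkℚᵘ (+ m) 0    ≤⟨ *≤* (ℤ.*-monoʳ-≤-nonNeg (+ 1) (+≤+ m≤n)) ⟩
    mkℚᵘ (+ n) 0    ≃⟨ toℚᵘ-fromℕ n ⟨
    toℚᵘ (fromℕ n)  ∎)
    where open ℚᵘ.≤-Reasoning

  fromℕ-+ : ∀ m n → fromℕ (m ℕ.+ n) ≡ fromℕ m + fromℕ n
  fromℕ-+ m n = ℚ.toℚᵘ-injective (begin
    toℚᵘ (fromℕ (m ℕ.+ n))                ≈⟨ toℚᵘ-fromℕ (m ℕ.+ n) ⟩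
    mkℚᵘ (+ (m ℕ.+ n)) 0                  ≈⟨ *≡* (cong (ℤ._* + 1) (trans (ℤ.pos-+ m n) (sym (cong₂ ℤ._+_ (ℤ.*-identityʳ (+ m)) (ℤ.*-identityʳ (+ n)))))) ⟩
    mkℚᵘ (+ m) 0 ℚᵘ.+ mkℚᵘ (+ n) 0        ≈⟨ ℚᵘ.+-cong (toℚᵘ-fromℕ m) (toℚᵘ-fromℕ n) ⟨
    toℚᵘ (fromℕ m) ℚᵘ.+ toℚᵘ (fromℕ n)    ≈⟨ ℚ.toℚᵘ-homo-+ (fromℕ m) (fromℕ n) ⟨
    toℚᵘ (fromℕ m + fromℕ n)              ∎)
    where open ℚᵘ.≃-Reasoning

  fromℕ-* : ∀ m n → fromℕ (m ℕ.* n) ≡ fromℕ m * fromℕ n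
  fromℕ-* m n = ℚ.toℚᵘ-injective (begin
    toℚᵘ (fromℕ (m ℕ.* n))                ≈⟨ toℚᵘ-fromℕ (m ℕ.* n) ⟩
    mkℚᵘ (+ (m ℕ.* n)) 0                  ≈⟨ *≡* (cong (ℤ._* + 1) (ℤ.pos-* m n)) ⟩
    mkℚᵘ (+ m) 0 ℚᵘ.* mkℚᵘ (+ n) 0        ≈⟨ ℚᵘ.*-cong (toℚᵘ-fromℕ m) (toℚᵘ-fromℕ n) ⟨
    toℚᵘ (fromℕ m) ℚᵘ.* toℚᵘ (fromℕ n)    ≈⟨ ℚ.toℚᵘ-homo-* (fromℕ m) (fromℕ n) ⟨
    toℚᵘ (fromℕ m * fromℕ n)              ∎)
    where open ℚᵘ.≃-Reasoning

  /-*-cancel : ∀ h d .{{_ : ℕ.NonZero d}} → (+ h / d) * fromℕ d ≡ fromℕ h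
  /-*-cancel h d@(suc d-1) = ℚ.toℚᵘ-injective (begin
    toℚᵘ ((+ h / d) * fromℕ d)            ≈⟨ ℚ.toℚᵘ-homo-* (+ h / d) (fromℕ d) ⟩
    toℚᵘ (+ h / d) ℚᵘ.* toℚᵘ (fromℕ d)    ≈⟨ ℚᵘ.*-cong (ℚ.toℚᵘ-fromℚᵘ (mkℚᵘ (+ h) d-1)) (toℚᵘ-fromℕ d) ⟩
    mkℚᵘ (+ h) d-1 ℚᵘ.* mkℚᵘ (+ d) 0      ≈⟨ *≡* (trans (ℤ.*-identityʳ (+ h ℤ.* + d)) (cong (λ x → + h ℤ.* + x) (sym (ℕ.*-identityʳ d)))) ⟩
    mkℚᵘ (+ h) 0                          ≈⟨ toℚᵘ-fromℕ h ⟨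
    toℚᵘ (fromℕ h)                        ∎)
    where open ℚᵘ.≃-Reasoning

  -- If ε = p/d with p ≥ 1, the hypothesis gives k ≤ n/d ≤ p n/d.
  archimedean : ∀ ε → 0ℚ < ε → ∀ k n → k ℕ.* ↧ₙ ε ℕ.≤ n → fromℕ k ≤ ε * fromℕ n
  archimedean ε 0<ε k n p = go ε {{positive 0<ε}} p
    where
    open ℚᵘ.≤-Reasoning
    go : ∀ ε .{{_ : Positive ε}} → k ℕ.* ↧ₙ ε ℕ.≤ n → fromℕ k ≤ ε * fromℕ n
    go ε@(mkℚ (+ suc p) d-1 _) k*d≤n = ℚ.toℚᵘ-cancel-≤ (begin
      toℚᵘ (fromℕ k)                        ≃⟨ toℚᵘ-fromℕ k ⟩
      mkℚᵘ (+ k) 0                          ≤⟨ *≤* (subst₂ ℤ._≤_ (ℤ.pos-* k (suc d-1 ℕ.* 1)) (trans (ℤ.pos-* (suc p) n) (sym (ℤ.*-identityʳ _))) (+≤+ ineq)) ⟩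
      mkℚᵘ (+ suc p) d-1 ℚᵘ.* mkℚᵘ (+ n) 0  ≃⟨ ℚᵘ.*-cong {toℚᵘ ε} ℚᵘ.≃-refl (toℚᵘ-fromℕ n) ⟨
      toℚᵘ ε ℚᵘ.* toℚᵘ (fromℕ n)            ≃⟨ ℚ.toℚᵘ-homo-* ε (fromℕ n) ⟨
      toℚᵘ (ε * fromℕ n)                    ∎)
      where
      ineq : k ℕ.* (suc d-1 ℕ.* 1) ℕ.≤ suc p ℕ.* n
      ineq = ℕ.≤-trans (ℕ.≤-trans (ℕ.≤-reflexive (cong (k ℕ.*_) (ℕ.*-identityʳ (suc d-1)))) k*d≤n) (ℕ.m≤m+n n (p ℕ.* n))

  fromℕ-nonNegative : ∀ n → NonNegative (fromℕ n)
  fromℕ-nonNegative n = nonNegative (fromℕ-mono-≤ {0} {n} z≤n)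

  fromℕ-positive : ∀ n .{{_ : ℕ.NonZero n}} → Positive (fromℕ n)
  fromℕ-positive n@(suc _) = ℚ.normalize-pos n 1

  -- From counts to densities

  module _ (n : ℕ) .{{_ : ℕ.NonZero n}} where

    private
      N : ℚ
      N = fromℕ (n ℕ.^ 5)
      instance
        n^5≢0 : ℕ.NonZero (n ℕ.^ 5)
        n^5≢0 = ℕ.m^n≢0 n 5

    density : ℕ → ℚ
    density h = + h / n ℕ.^ 5

    -- Absorbs an error of order n⁴ into an ε fraction of n⁵.
    fromℕ-n^4≤ : ∀ ε k → fromℕ k ≤ ε * fromℕ n → fromℕ k * fromℕ (n ℕ.^ 4) ≤ ε * N
    fromℕ-n^4≤ ε k p = begin
      fromℕ k * fromℕ (n ℕ.^ 4)        ≤⟨ ℚ.*-monoʳ-≤-nonNeg (fromℕ (n ℕ.^ 4)) {{fromℕ-nonNegative (n ℕ.^ 4)}} p ⟩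
      ε * fromℕ n * fromℕ (n ℕ.^ 4)    ≡⟨ ℚ.*-assoc ε (fromℕ n) _ ⟩
      ε * (fromℕ n * fromℕ (n ℕ.^ 4))  ≡⟨ cong (ε *_) (fromℕ-* n (n ℕ.^ 4)) ⟨
      ε * N                            ∎
      where open ℚ.≤-Reasoning

    density-upper : ∀ ε h → 32 ℕ.* h ℕ.≤ n ℕ.^ 5 ℕ.+ 32 ℕ.* n ℕ.^ 4 → fromℕ 1 ≤ ε * fromℕ n →
      density h ≤ + 1 / 32 + ε
    density-upper ε h p q = ℚ.*-cancelˡ-≤-pos (fromℕ 32) (ℚ.*-cancelʳ-≤-pos N {{fromℕ-positive (n ℕ.^ 5)}} (begin
      fromℕ 32 * density h * N               ≡⟨ ℚ.*-assoc (fromℕ 32) (density h) N ⟩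
      fromℕ 32 * (density h * N)             ≡⟨ cong (fromℕ 32 *_) (/-*-cancel h (n ℕ.^ 5)) ⟩
      fromℕ 32 * fromℕ h                     ≡⟨ fromℕ-* 32 h ⟨
      fromℕ (32 ℕ.* h)                       ≤⟨ fromℕ-mono-≤ p ⟩
      fromℕ (n ℕ.^ 5 ℕ.+ 32 ℕ.* n ℕ.^ 4)     ≡⟨ fromℕ-+ (n ℕ.^ 5) _ ⟩
      N + fromℕ (32 ℕ.* n ℕ.^ 4)             ≡⟨ cong (_+_ N) (fromℕ-* 32 (n ℕ.^ 4)) ⟩
      N + fromℕ 32 * fromℕ (n ℕ.^ 4)         ≡⟨ cong (λ x → N + fromℕ 32 * x) (ℚ.*-identityˡ (fromℕ (n ℕ.^ 4))) ⟨
      N + fromℕ 32 * (fromℕ 1 * fromℕ (n ℕ.^ 4)) ≤⟨ ℚ.+-monoʳ-≤ N (ℚ.*-monoˡ-≤-nonNeg (fromℕ 32) (fromℕ-n^4≤ ε 1 q)) ⟩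
      N + fromℕ 32 * (ε * N)                 ≡⟨ solve 2 (λ N ε → N :+ con (fromℕ 32) :* (ε :* N) := con (fromℕ 32) :* (con (+ 1 / 32) :+ ε) :* N) refl N ε ⟩
      fromℕ 32 * (+ 1 / 32 + ε) * N          ∎))
      where open ℚ.≤-Reasoning

    density-lower : ∀ ε h₁ h₂ → n ℕ.^ 5 ℕ.≤ 16 ℕ.* (h₁ ℕ.+ h₂) ℕ.+ 80 ℕ.* n ℕ.^ 4 → fromℕ 5 ≤ ε * fromℕ n →
      + 1 / 16 - ε ≤ density h₁ + density h₂
    density-lower ε h₁ h₂ p q = ℚ.*-cancelˡ-≤-pos (fromℕ 16) (ℚ.*-cancelʳ-≤-pos N {{fromℕ-positive (n ℕ.^ 5)}} (begin
      fromℕ 16 * (+ 1 / 16 - ε) * N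
        ≡⟨ solve 2 (λ N ε → con (fromℕ 16) :* (con (+ 1 / 16) :- ε) :* N := N :- con (fromℕ 16) :* (ε :* N)) refl N ε ⟩
      N - e
        ≤⟨ ℚ.+-monoˡ-≤ (- e) (fromℕ-mono-≤ p) ⟩
      fromℕ (16 ℕ.* (h₁ ℕ.+ h₂) ℕ.+ 80 ℕ.* n ℕ.^ 4) - e
        ≡⟨ cong (_- e) (fromℕ-+ (16 ℕ.* (h₁ ℕ.+ h₂)) _) ⟩
      fromℕ (16 ℕ.* (h₁ ℕ.+ h₂)) + fromℕ (80 ℕ.* n ℕ.^ 4) - e
        ≡⟨ cong₂ (λ x y → x + y - e) (trans (fromℕ-* 16 (h₁ ℕ.+ h₂)) (cong (fromℕ 16 *_) (fromℕ-+ h₁ h₂))) (fromℕ-* 80 (n ℕ.^ 4)) ⟩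
      fromℕ 16 * (fromℕ h₁ + fromℕ h₂) + fromℕ 80 * fromℕ (n ℕ.^ 4) - e
        -- `fromℕ 80` evaluates to `fromℕ 16 * fromℕ 5`; this isolates the error that `q` controls.
        ≡⟨ cong (λ x → fromℕ 16 * (fromℕ h₁ + fromℕ h₂) + x - e) (ℚ.*-assoc (fromℕ 16) (fromℕ 5) (fromℕ (n ℕ.^ 4))) ⟩
      fromℕ 16 * (fromℕ h₁ + fromℕ h₂) + fromℕ 16 * (fromℕ 5 * fromℕ (n ℕ.^ 4)) - e
        ≤⟨ ℚ.+-monoˡ-≤ (- e) (ℚ.+-monoʳ-≤ (fromℕ 16 * (fromℕ h₁ + fromℕ h₂)) (ℚ.*-monoˡ-≤-nonNeg (fromℕ 16) (fromℕ-n^4≤ ε 5 q))) ⟩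
      fromℕ 16 * (fromℕ h₁ + fromℕ h₂) + e - e
        ≡⟨ cong₂ (λ x y → fromℕ 16 * (x + y) + e - e) (/-*-cancel h₁ (n ℕ.^ 5)) (/-*-cancel h₂ (n ℕ.^ 5)) ⟨
      fromℕ 16 * (density h₁ * N + density h₂ * N) + e - e
        ≡⟨ solve 4 (λ x y N e → con (fromℕ 16) :* (x :* N :+ y :* N) :+ e :- e := con (fromℕ 16) :* (x :+ y) :* N) refl (density h₁) (density h₂) N e ⟩
      fromℕ 16 * (density h₁ + density h₂) * N ∎))
      where
      open ℚ.≤-Reasoning
      e = fromℕ 16 * (ε * N)

  -- The limits inferior

  m≤2^m : ∀ m → m ℕ.≤ 2 ℕ.^ m
  m≤2^m zero    = z≤n
  m≤2^m (suc m) = ℕ.+-mono-≤ (ℕ.m^n>0 2 m) (ℕ.≤-trans (m≤2^m m) (ℕ.≤-reflexive (sym (ℕ.+-identityʳ (2 ℕ.^ m)))))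

  -- The weights `lam` and `2 - lam` are nonnegative and add up to 2. Two densities of at most 1/32
  -- + ε/2 therefore give at most 1/16 + ε, whatever `lam` is.
  liminf≤ : ∀ lam → 0ℚ ≤ lam → lam ≤ + 2 / 1 → LiminfLe (objective C5 Banner lam) (+ 1 / 16)
  liminf≤ lam 0≤lam lam≤2 ε 0<ε M = n , n≢0 , M≤n , G , bound
    where
    m n : ℕ
    -- As `m ≤ 2 ^ m`, this makes the order at least `M` and large enough for 2 ≤ ε n, that is, 1 ≤
    -- (ε/2) n.
    m = M ℕ.+ 2 ℕ.* ↧ₙ ε
    n = 2 ℕ.^ m
    n≢0 : ℕ.NonZero n
    n≢0 = ℕ.m^n≢0 2 m
    instance _ = n≢0
    G : Graph n
    G = sylvesterGraph m
    M≤n : M ℕ.≤ n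
    M≤n = ℕ.≤-trans (ℕ.m≤m+n M _) (m≤2^m m)
    half = + 1 / 2
    1≤ : fromℕ 1 ≤ ε * half * fromℕ n
    1≤ = begin
      half * fromℕ 2        ≤⟨ ℚ.*-monoˡ-≤-nonNeg half {fromℕ 2} (archimedean ε 0<ε 2 n (ℕ.≤-trans (ℕ.m≤n+m _ M) (m≤2^m m))) ⟩
      half * (ε * fromℕ n)  ≡⟨ solve 3 (λ h e n → h :* (e :* n) := e :* h :* n) refl half ε (fromℕ n) ⟩
      ε * half * fromℕ n    ∎
      where open ℚ.≤-Reasoning
    bound : objective C5 Banner lam n G ≤ + 1 / 16 + ε
    bound = begin
      lam * t C5 G + (+ 2 / 1 - lam) * t Banner (complement G)
        ≤⟨ ℚ.+-mono-≤ (ℚ.*-monoˡ-≤-nonNeg lam {{nonNegative 0≤lam}} (density-upper n (ε * half) (hom C5 G) (hom-C5-sylvester m) 1≤))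
             (ℚ.*-monoˡ-≤-nonNeg (+ 2 / 1 - lam) {{nonNegative 0≤2-lam}}
               (density-upper n (ε * half) (hom Banner (complement G)) (hom-Banner-sylvester m) 1≤)) ⟩
      lam * (+ 1 / 32 + ε * half) + (+ 2 / 1 - lam) * (+ 1 / 32 + ε * half)
        ≡⟨ solve 2 (λ l e → l :* (con (+ 1 / 32) :+ e :* con half) :+ (con (+ 2 / 1) :- l) :* (con (+ 1 / 32) :+ e :* con half)
             := con (+ 1 / 16) :+ e) refl lam ε ⟩
      + 1 / 16 + ε ∎
      where
      open ℚ.≤-Reasoning
      0≤2-lam : 0ℚ ≤ + 2 / 1 - lam
      0≤2-lam = subst (_≤ + 2 / 1 - lam) (ℚ.+-inverseʳ lam) (ℚ.+-monoˡ-≤ (- lam) lam≤2)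

  -- At λ = 1 both weights evaluate to 1, so the objective is the sum of the two densities. The
  -- threshold ensures 5 ≤ ε n, as `density-lower` demands.
  liminf≥ : LiminfGe (objective C5 Banner 1ℚ) (+ 1 / 16)
  liminf≥ ε 0<ε = 5 ℕ.* ↧ₙ ε , λ n M≤n G → subst (+ 1 / 16 - ε ≤_)
    (cong₂ _+_ (sym (ℚ.*-identityˡ (t C5 G))) (sym (ℚ.*-identityˡ (t Banner (complement G)))))
    (density-lower n ε (hom C5 G) (hom Banner (complement G)) (n^5≤16homs+80n^4 G) (archimedean ε 0<ε 5 n M≤n))

  LiminfGe-weaken : ∀ {F x} y → y ≤ x → LiminfGe F x → LiminfGe F y
  LiminfGe-weaken y y≤x p ε 0<ε with p ε 0<ε
  ... | M , q = M , λ n M≤n G → ℚ.≤-trans (ℚ.+-monoˡ-≤ (- ε) y≤x) (q n M≤n G)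

open Limits

theorem1p9 : IsC C5 Banner (+ 1 / 16) × IsCλ C5 Banner 1ℚ (+ 1 / 16)
theorem1p9 =
  -- The supremum is attained at λ = 1, where the bound holds even without subtracting ε.
  (liminf≤ , λ ε 0<ε → 1ℚ , 0≤1 , 1≤2 , LiminfGe-weaken (+ 1 / 16 ℚ.- ε) (x-ε≤x ε 0<ε) liminf≥) ,
  (liminf≥ , liminf≤ 1ℚ 0≤1 1≤2)
  where
  0≤1 : 0ℚ ℚ.≤ 1ℚ
  0≤1 = fromℕ-mono-≤ {0} {1} z≤n
  1≤2 : 1ℚ ℚ.≤ + 2 / 1
  1≤2 = fromℕ-mono-≤ {1} {2} (s≤s z≤n)
  x-ε≤x : ∀ ε → 0ℚ ℚ.< ε → + 1 / 16 ℚ.- ε ℚ.≤ + 1 / 16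
  x-ε≤x ε 0<ε = ℚ.+-monoʳ-≤ (+ 1 / 16) (ℚ.neg-antimono-≤ (ℚ.<⇒≤ 0<ε))
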